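{- Let $r\ge 2$ be an integer and write $r=a+3b$ with $a\in\{2,3,4\}$ and $b\ge 0$ an integer. Then \[w(k;r) > (a3^b)^{(1-o_r(1))k},\] where $o_r(1)$ denotes a quantity tending to $0$ as $k\to\infty$ with $r$ fixed; that is, for every integer $r\ge 2$ and every $\eta>0$ there exists $K$ such that $w(k;r)>(a3^b)^{(1-\eta)k}$ for all integers $k>K$. Moreover, in terms of the inverse function, \[f_r(N)\le O\left(\frac{\log N}{r}\right)+O_r(1);\] that is, there exist an absolute constant $C>0$ and, for each integer $r\ge 2$, a constant $D_r$ such that $f_r(N)\le C\,\frac{\log N}{r}+D_r$ for all integers $N\ge 1$.
   Context: For a positive integer $n$, $[n]=\{1,\dots,n\}$. A $k$-term arithmetic progression of integers is a set $\{x,x+d,\dots,x+(k-1)d\}$ with $d\ne 0$. For positive integers $k,r$, the van der Waerden number $w(k;r)$ is the smallest integer $N$ such that for every $r$-coloring $c:[N]\to[r]$ there exists a monochromatic $k$-term arithmetic progression in $[N]$. The function $f_r(N)$ is the smallest $k$ such that there exists an $r$-coloring $c:[N]\to[r]$ with no monochromatic arithmetic progression of length $k$. -}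

module Defs where

open import Data.Nat as ℕ using (ℕ; suc)
open import Data.Integer as ℤ using (ℤ; +_; -[1+_]; 0ℤ)
open import Data.Rational as ℚ using (ℚ; 1ℚ; ↥_; ↧_)
open import Data.Fin using (Fin; toℕ)
open import Data.Product using (_×_; ∃-syntax)
open import Relation.Nullary using (¬_)
open import Relation.Binary.PropositionalEquality using (_≡_; _≢_)

-- [ n ] = {1, …, n} is represented by Fin n, with m : Fin n standing for
-- the integer ⟦ m ⟧ = toℕ m + 1.

⟦_⟧ : ∀ {n} → Fin n → ℤ
⟦ m ⟧ = + suc (toℕ m)

Coloring : ℕ → ℕ → Set
Coloring r N = Fin N → Fin r

HasMonoAP : ∀ {r N} → ℕ → Coloring r N → Set
HasMonoAP {r} {N} k c =
  ∃[ x ] ∃[ d ] d ≢ 0ℤ × ∃[ j ] ((i : Fin k) →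
    ∃[ m ] ⟦ m ⟧ ≡ x ℤ.+ + toℕ i ℤ.* d × c m ≡ j)

IsLeast : (ℕ → Set) → ℕ → Set
IsLeast P n = P n × (∀ m → P m → n ℕ.≤ m)

-- n = w(k;r).  A relation rather than a function, since totality of w is
-- van der Waerden's theorem.
Is-w : (k r n : ℕ) → Set
Is-w k r = IsLeast λ N → (c : Coloring r N) → HasMonoAP k c

-- k = f_r(N).
Is-f : (r N k : ℕ) → Set
Is-f r N = IsLeast λ k → ∃[ c ] ¬ HasMonoAP {r} {N} k c

infix 9 _⁺ _⁻

_⁺ _⁻ : ℤ → ℕ
(+ n)    ⁺ = n
-[1+ n ] ⁺ = 0
(+ n)    ⁻ = 0
-[1+ n ] ⁻ = suc n

-- Comparison of the real numbers a ^ x and b ^ y for positive naturals a, b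
-- and rationals x = p / q, y = s / t: raise both sides to the power q t > 0,
-- giving a ^ (p t) against b ^ (s q), then move the powers with negative
-- exponent to the other side.
ComparePowers : (ℕ → ℕ → Set) → ℕ → ℚ → ℕ → ℚ → Set
ComparePowers _∼_ a x b y =
  (a ℕ.^ u ⁺ ℕ.* b ℕ.^ v ⁻) ∼ (b ℕ.^ v ⁺ ℕ.* a ℕ.^ u ⁻)
  where
  u v : ℤ
  u = ↥ x ℤ.* ↧ y
  v = ↥ y ℤ.* ↧ x

infix 4 _↑_<_ _≤_*log₂_

_↑_<_ : ℕ → ℚ → ℕ → Set
a ↑ x < n = ComparePowers ℕ._<_ a x n 1ℚ

-- x ≤ y · log₂ n, for n ≥ 1, in the exponentiated form 2 ^ x ≤ n ^ y.
_≤_*log₂_ : ℚ → ℚ → ℕ → Set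
x ≤ y *log₂ n = ComparePowers ℕ._≤_ 2 x n y

fromℕ : ℕ → ℚ
fromℕ n = + n ℚ./ 1

-- Two colourings are combined so that the sizes multiply while the numbers of colours add.  Let q be
-- a power of a prime p′ ≥ k and let g colour ℤ/q without monochromatic k-term progressions; the local
-- lemma, in Rosenfeld's counting form, gives c colours on q ≥ c^(k - o(k)) points.  Let f be such a
-- colouring of {0, …, M - 1}.  Write n < M q as n = x q + y and fix a prime p ≤ k with k = O(p) and a
-- random φ : ℤ/q → ℤ/p.  Colour n by f x if φ y is one of the base p digits of x, and by g y (in new
-- colours) otherwise.  A progression with constant y moves x along a progression, some digit of which
-- takes all p values, so it must use a colour of f, which excludes it.  If y is not constant, then g
-- excludes a colour of g, and a colour of f would need φ to hit one of m digits k times.  That has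
-- probability (m / p)^k at most, so a union bound excludes it for every progression at once if p / m
-- is a large constant, since M q is only exponential in k.
-- Starting from a colours and adding 3 colours b times gives (a 3^b)^((1 - o(1)) k).

module Submission where

-- When `d` is not a multiple of `q`, carries keep the quotients `x` from forming a progression, so
-- nothing structural is known about their digits. What survives is that the residues `y` are
-- distinct, which makes the values of `φ` at them independent. Hence `q` must have no prime factor
-- below `k`, while `p` must not exceed `k`, so that the terms over a constant `y` reach every
-- residue modulo `p`.
--
-- Only orders of magnitude matter for the primes: `p` is needed within a constant factor of `k`,
-- and powers of a prime polynomial in `k` approximate the bound of the local lemma up to a
-- polynomial factor. A weak Chebyshev theorem, giving a prime between `4 ^ i` and `4 ^ (2 + i)`, is
-- therefore enough.
--
-- Colours are added in threes because `c ^ (1 / c)` is largest at `c = 3` among the integers. The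
-- number of steps depends on `r` alone, so the accumulated loss stays polynomial in `k`.

-- Chebyshev-type bounds for primes.

module Primes where

  open import Data.Nat
  open import Data.Nat.Properties
  open import Data.Nat.Divisibility
  open import Data.Nat.DivMod using (m/n*n≡m)
  open import Data.Nat.Combinatorics using (_C_; nCk≡n!/k![n-k]!; k![n∸k]!∣n!)
  open import Data.Nat.Primality
  open import Data.Nat.Primality.Factorisation using (factorise; module PrimeFactorisation)
  open import Data.Nat.Coprimality using (Coprime; coprime-divisor)
  open import Data.Nat.ListAction using (product)
  open import Data.Nat.Tactic.RingSolver using (solve-∀)
  open import Data.List using ([]; _∷_; length)
  import Data.List.Relation.Unary.All
  open import Data.List.Relation.Unary.All using (All; []; _∷_)
  open import Data.Product using (_×_; _,_; ∃-syntax)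
  open import Data.Empty
  open import Data.Sum
  open import Relation.Nullary
  open import Relation.Binary.PropositionalEquality
  open import Function using (_∘_)
  open import Relation.Nullary.Decidable using (_×-dec_)

  open ≤-Reasoning

  binomial : ℕ → ℕ → ℕ
  binomial a b = (a + b) C a

  binomial-! : ∀ a b → binomial a b * (a ! * b !) ≡ (a + b) !
  binomial-! a b = begin-equality
    binomial a b * (a ! * b !)
      ≡⟨ cong (λ z → binomial a b * (a ! * z !)) (m+n∸m≡n a b) ⟨
    binomial a b * (a ! * (a + b ∸ a) !)
      ≡⟨ cong (_* (a ! * (a + b ∸ a) !)) (nCk≡n!/k![n-k]! (m≤m+n a b)) ⟩
    ((a + b) ! / (a ! * (a + b ∸ a) !)) * (a ! * (a + b ∸ a) !)
      ≡⟨ m/n*n≡m (k![n∸k]!∣n! (m≤m+n a b)) ⟩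
    (a + b) ! ∎
    where instance _ = a !* (a + b ∸ a) !≢0

  binomial-sucˡ : ∀ a b → suc a * binomial (suc a) b ≡ suc (a + b) * binomial a b
  binomial-sucˡ a b = *-cancelʳ-≡ _ _ (a ! * b !) (begin-equality
    suc a * binomial (suc a) b * (a ! * b !)     ≡⟨ rearrange (suc a) (binomial (suc a) b) (a !) (b !) ⟩
    binomial (suc a) b * (suc a ! * b !)         ≡⟨ binomial-! (suc a) b ⟩
    suc (a + b) * (a + b) !                      ≡⟨ cong (suc (a + b) *_) (binomial-! a b) ⟨
    suc (a + b) * (binomial a b * (a ! * b !))   ≡⟨ *-assoc (suc (a + b)) (binomial a b) (a ! * b !) ⟨
    suc (a + b) * binomial a b * (a ! * b !)     ∎)
    where
    instance _ = a !* b !≢0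
    rearrange : ∀ s t x y → s * t * (x * y) ≡ t * (s * x * y)
    rearrange = solve-∀

  binomial-sucʳ : ∀ a b → suc b * binomial a (suc b) ≡ suc (a + b) * binomial a b
  binomial-sucʳ a b = *-cancelʳ-≡ _ _ (a ! * b !) (begin-equality
    suc b * binomial a (suc b) * (a ! * b !)     ≡⟨ rearrange (suc b) (binomial a (suc b)) (a !) (b !) ⟩
    binomial a (suc b) * (a ! * suc b !)         ≡⟨ binomial-! a (suc b) ⟩
    (a + suc b) !                                ≡⟨ cong _! (+-suc a b) ⟩
    suc (a + b) * (a + b) !                      ≡⟨ cong (suc (a + b) *_) (binomial-! a b) ⟨
    suc (a + b) * (binomial a b * (a ! * b !))   ≡⟨ *-assoc (suc (a + b)) (binomial a b) (a ! * b !) ⟨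
    suc (a + b) * binomial a b * (a ! * b !)     ∎)
    where
    instance _ = a !* b !≢0
    rearrange : ∀ s t x y → s * t * (x * y) ≡ t * (x * (s * y))
    rearrange = solve-∀

  central : ℕ → ℕ
  central m = binomial m m

  central-suc : ∀ m → suc m * central (suc m) ≡ 2 * (suc (2 * m) * central m)
  central-suc m = *-cancelˡ-≡ _ _ (suc m) (begin-equality
    suc m * (suc m * central (suc m))
      ≡⟨ cong (suc m *_) (binomial-sucˡ m (suc m)) ⟩
    suc m * (suc (m + suc m) * binomial m (suc m))
      ≡⟨ first m (binomial m (suc m)) ⟩
    2 * suc m * (suc m * binomial m (suc m))
      ≡⟨ cong (2 * suc m *_) (binomial-sucʳ m m) ⟩
    2 * suc m * (suc (m + m) * central m)
      ≡⟨ second m (central m) ⟩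
    suc m * (2 * (suc (2 * m) * central m)) ∎)
    where
    first : ∀ m x → suc m * (suc (m + suc m) * x) ≡ 2 * suc m * (suc m * x)
    first = solve-∀
    second : ∀ m x → 2 * suc m * (suc (m + m) * x) ≡ suc m * (2 * (suc (2 * m) * x))
    second = solve-∀

  central≤4^ : ∀ m → central m ≤ 4 ^ m
  central≤4^ zero = ≤-refl
  central≤4^ (suc m) = *-cancelˡ-≤ (suc m) (begin
    suc m * central (suc m)         ≡⟨ central-suc m ⟩
    2 * (suc (2 * m) * central m)   ≤⟨ *-monoʳ-≤ 2 (*-mono-≤ (m≤n+m (suc (2 * m)) 1) (central≤4^ m)) ⟩
    2 * (suc (suc (2 * m)) * 4 ^ m) ≡⟨ rearrange m (4 ^ m) ⟩
    suc m * (4 * 4 ^ m)             ∎)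
    where
    rearrange : ∀ m x → 2 * (suc (suc (2 * m)) * x) ≡ suc m * (4 * x)
    rearrange = solve-∀

  -- The right-hand side is the denominator of a central entry of Leibniz' triangle, so with
  -- `leibniz-∣` this bounds every nonzero common multiple of an initial segment from below.
  4^≤central : ∀ m → 4 ^ m ≤ suc (2 * m) * central m
  4^≤central zero = ≤-refl
  4^≤central (suc m) = *-cancelˡ-≤ (suc m) (begin
    suc m * (4 * 4 ^ m)                                    ≤⟨ *-monoʳ-≤ (suc m) (*-monoʳ-≤ 4 (4^≤central m)) ⟩
    suc m * (4 * (suc (2 * m) * central m))                ≡⟨ first m (suc (2 * m) * central m) ⟩
    suc (suc (2 * m)) * (2 * (suc (2 * m) * central m))    ≡⟨ cong (suc (suc (2 * m)) *_) (central-suc m) ⟨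
    suc (suc (2 * m)) * (suc m * central (suc m))          ≤⟨ *-monoˡ-≤ (suc m * central (suc m)) (n≤1+n (suc (suc (2 * m)))) ⟩
    suc (suc (suc (2 * m))) * (suc m * central (suc m))    ≡⟨ second m (central (suc m)) ⟩
    suc m * (suc (2 * suc m) * central (suc m))            ∎)
    where
    first : ∀ m x → suc m * (4 * x) ≡ suc (suc (2 * m)) * (2 * x)
    first = solve-∀
    second : ∀ m x → suc (suc (suc (2 * m))) * (suc m * x) ≡ suc m * (suc (2 * suc m) * x)
    second = solve-∀

  -- The entries of Leibniz' harmonic triangle are 1 / ((a + b + 1) * binomial a b), and each is a
  -- difference of two entries nearer to the border 1, 1/2, 1/3, …
  leibniz-∣ : ∀ K R → (∀ j → 0 < j → j ≤ K → j ∣ R) →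
              ∀ a b → a + b < K → suc (a + b) * binomial a b ∣ R
  leibniz-∣ K R small∣R zero b b<K = subst (_∣ R) (sym (*-identityʳ (suc b))) (small∣R (suc b) z<s b<K)
  leibniz-∣ K R small∣R (suc a) b 1+a+b<K
    with leibniz-∣ K R small∣R a b (<-trans (n<1+n (a + b)) 1+a+b<K)
       | leibniz-∣ K R small∣R a (suc b) (subst (_< K) (sym (+-suc a b)) 1+a+b<K)
  ... | divides α R≡αL | divides β R≡βL =
    ∣m+n∣m⇒∣n (divides α (*-cancelˡ-≡ _ _ (suc a) (begin-equality
      suc a * (β * L + R)                 ≡⟨ *-distribˡ-+ (suc a) (β * L) R ⟩
      suc a * (β * L) + suc a * R         ≡⟨ cong (_+ suc a * R) β-part ⟩
      suc b * R + suc a * R               ≡⟨ *-distribʳ-+ R (suc b) (suc a) ⟨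
      (suc b + suc a) * R                 ≡⟨ cong (_* R) (trans (+-comm (suc b) (suc a)) (cong suc (+-suc a b))) ⟩
      suc (suc (a + b)) * R               ≡⟨ α-part ⟨
      suc a * (α * L)                     ∎)))
      (divides β refl)
    where
    P T X L : ℕ
    P = binomial a b
    T = binomial a (suc b)
    X = binomial (suc a) b
    L = suc (suc (a + b)) * X
    swap₁ : ∀ s t u v → s * (t * (u * v)) ≡ t * u * (s * v)
    swap₁ = solve-∀
    swap₂ : ∀ s t u v → t * u * (s * v) ≡ u * (t * (s * v))
    swap₂ = solve-∀
    α-part : suc a * (α * L) ≡ suc (suc (a + b)) * R
    α-part = begin-equality
      suc a * (α * L)                                 ≡⟨ swap₁ (suc a) α (suc (suc (a + b))) X ⟩
      α * suc (suc (a + b)) * (suc a * X)             ≡⟨ cong (α * suc (suc (a + b)) *_) (binomial-sucˡ a b) ⟩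
      α * suc (suc (a + b)) * (suc (a + b) * P)       ≡⟨ swap₂ (suc (a + b)) α (suc (suc (a + b))) P ⟩
      suc (suc (a + b)) * (α * (suc (a + b) * P))     ≡⟨ cong (suc (suc (a + b)) *_) R≡αL ⟨
      suc (suc (a + b)) * R                           ∎
    β-part : suc a * (β * L) ≡ suc b * R
    β-part = begin-equality
      suc a * (β * L)                                 ≡⟨ swap₁ (suc a) β (suc (suc (a + b))) X ⟩
      β * suc (suc (a + b)) * (suc a * X)             ≡⟨ cong (β * suc (suc (a + b)) *_)
                                                          (trans (binomial-sucˡ a b) (sym (binomial-sucʳ a b))) ⟩
      β * suc (suc (a + b)) * (suc b * T)             ≡⟨ swap₁ (suc b) β (suc (suc (a + b))) T ⟨
      suc b * (β * (suc (suc (a + b)) * T))           ≡⟨ cong (λ z → suc b * (β * (suc z * T))) (+-suc a b) ⟨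
      suc b * (β * (suc (a + suc b) * T))             ≡⟨ cong (suc b *_) R≡βL ⟨
      suc b * R                                       ∎

  primorial : ℕ → ℕ
  primorial zero = 1
  primorial (suc n) with prime? (suc n)
  ... | yes _ = suc n * primorial n
  ... | no  _ = primorial n

  prime∣primorial : ∀ n {p} → Prime p → p ≤ n → p ∣ primorial n
  prime∣primorial zero pp p≤0 = contradiction pp (subst (¬_ ∘ Prime) (sym (n≤0⇒n≡0 p≤0)) ¬prime[0])
  prime∣primorial (suc n) {p} pp p≤1+n with prime? (suc n) | m≤n⇒m<n∨m≡n p≤1+n
  ... | yes _ | inj₁ p<1+n = ∣n⇒∣m*n (suc n) (prime∣primorial n pp (≤-pred p<1+n))
  ... | yes _ | inj₂ refl  = m∣m*n (primorial n)
  ... | no _  | inj₁ p<1+n = prime∣primorial n pp (≤-pred p<1+n)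
  ... | no ¬q | inj₂ refl  = contradiction pp ¬q

  prime∣!⇒≤ : ∀ n {p} → Prime p → p ∣ n ! → p ≤ n
  prime∣!⇒≤ zero pp p∣1 = contradiction pp (subst (¬_ ∘ Prime) (sym (∣1⇒≡1 p∣1)) ¬prime[1])
  prime∣!⇒≤ (suc n) pp p∣ with euclidsLemma (suc n) (n !) pp p∣
  ... | inj₁ p∣1+n = ∣⇒≤ p∣1+n
  ... | inj₂ p∣n!  = m≤n⇒m≤1+n (prime∣!⇒≤ n pp p∣n!)

  ≤⇒∣! : ∀ n {j} → 0 < j → j ≤ n → j ∣ n !
  ≤⇒∣! zero 0<j j≤0 = contradiction (<-≤-trans 0<j j≤0) (λ ())
  ≤⇒∣! (suc n) 0<j j≤1+n with m≤n⇒m<n∨m≡n j≤1+n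
  ... | inj₁ j<1+n = ∣n⇒∣m*n (suc n) (≤⇒∣! n 0<j (≤-pred j<1+n))
  ... | inj₂ refl  = m∣m*n (n !)

  prime∣central : ∀ m {p} → Prime p → m < p → p ≤ m + m → p ∣ central m
  prime∣central m {p} pp m<p p≤2m
    with euclidsLemma (central m) (m ! * m !) pp
           (subst (p ∣_) (sym (binomial-! m m)) (≤⇒∣! (m + m) (≤-<-trans z≤n m<p) p≤2m))
  ... | inj₁ p∣C = p∣C
  ... | inj₂ p∣! with euclidsLemma (m !) (m !) pp p∣!
  ...   | inj₁ p∣m! = contradiction (prime∣!⇒≤ m pp p∣m!) (<⇒≱ m<p)
  ...   | inj₂ p∣m! = contradiction (prime∣!⇒≤ m pp p∣m!) (<⇒≱ m<p)

  primesIn : ℕ → ℕ → ℕ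
  primesIn m zero = 1
  primesIn m (suc j) with prime? (suc (m + j))
  ... | yes _ = suc (m + j) * primesIn m j
  ... | no  _ = primesIn m j

  primorial-+ : ∀ m j → primorial (m + j) ≡ primesIn m j * primorial m
  primorial-+ m zero = trans (cong primorial (+-identityʳ m)) (sym (*-identityˡ _))
  primorial-+ m (suc j) rewrite +-suc m j with prime? (suc (m + j))
  ... | yes _ = trans (cong (suc (m + j) *_) (primorial-+ m j)) (sym (*-assoc (suc (m + j)) (primesIn m j) (primorial m)))
  ... | no  _ = primorial-+ m j

  prime∣primesIn⇒≤ : ∀ m j {p} → Prime p → p ∣ primesIn m j → p ≤ m + j
  prime∣primesIn⇒≤ m zero pp p∣1 = contradiction pp (subst (¬_ ∘ Prime) (sym (∣1⇒≡1 p∣1)) ¬prime[1])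
  prime∣primesIn⇒≤ m (suc j) {p} pp p∣ rewrite +-suc m j with prime? (suc (m + j))
  ... | no _  = m≤n⇒m≤1+n (prime∣primesIn⇒≤ m j pp p∣)
  ... | yes _ with euclidsLemma (suc (m + j)) _ pp p∣
  ...   | inj₁ p∣s = ∣⇒≤ p∣s
  ...   | inj₂ p∣r = m≤n⇒m≤1+n (prime∣primesIn⇒≤ m j pp p∣r)

  prime∤⇒coprime : ∀ {p n} → Prime p → p ∤ n → Coprime p n
  prime∤⇒coprime pp p∤n (d∣p , d∣n) with prime⇒irreducible pp d∣p
  ... | inj₁ d≡1  = d≡1
  ... | inj₂ refl = contradiction d∣n p∤n

  -- Each prime of the interval divides `central m` by itself. A new prime exceeds all prime factors
  -- of the product so far, hence is coprime to it, and the divisibilities multiply.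
  primesIn∣central : ∀ m j → j ≤ m → primesIn m j ∣ central m
  primesIn∣central m zero _ = 1∣ central m
  primesIn∣central m (suc j) j<m with prime? (suc (m + j)) | primesIn∣central m j (<⇒≤ j<m)
  ... | no _   | D∣C = D∣C
  ... | yes pp | divides x C≡xD = subst (suc (m + j) * primesIn m j ∣_) (sym C≡xD)
    (*-monoˡ-∣ (primesIn m j) (coprime-divisor
      (prime∤⇒coprime pp (λ p∣D → <-irrefl refl (prime∣primesIn⇒≤ m j pp p∣D)))
      (subst (suc (m + j) ∣_) (trans C≡xD (*-comm x _))
        (prime∣central m pp (s≤s (m≤m+n m j)) (subst (_≤ m + m) (+-suc m j) (+-monoʳ-≤ m j<m))))))

  central≢0 : ∀ m → NonZero (central m)
  central≢0 m = ≢-nonZero λ C≡0 → contradiction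
    (≤-trans (subst (λ z → 4 ^ m ≤ suc (2 * m) * z) C≡0 (4^≤central m)) (≤-reflexive (*-zeroʳ (suc (2 * m)))))
    (<⇒≱ (m^n>0 4 m))

  -- Erdős' doubling argument: the primes between `m` and `2 m` multiply to a divisor of
  -- `central m`, which is at most `4 ^ m`. Powers of two suffice, since the bound is applied at a
  -- power of four.
  primorial-2^ : ∀ i → primorial (2 ^ i) ≤ 4 ^ (2 ^ i)
  primorial-2^ zero = s≤s z≤n
  primorial-2^ (suc i) = begin
    primorial (m + (m + 0))              ≡⟨ cong (λ z → primorial (m + z)) (+-identityʳ m) ⟩
    primorial (m + m)                    ≡⟨ primorial-+ m m ⟩
    primesIn m m * primorial m           ≤⟨ *-mono-≤ (≤-trans (∣⇒≤ {{central≢0 m}} (primesIn∣central m m ≤-refl)) (central≤4^ m)) (primorial-2^ i) ⟩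
    4 ^ m * 4 ^ m                        ≡⟨ ^-distribˡ-+-* 4 m m ⟨
    4 ^ (m + m)                          ≡⟨ cong (λ z → 4 ^ (m + z)) (+-identityʳ m) ⟨
    4 ^ (m + (m + 0))                    ∎
    where m = 2 ^ i

  primorial>0 : ∀ n → 0 < primorial n
  primorial>0 zero = s≤s z≤n
  primorial>0 (suc n) with prime? (suc n)
  ... | yes _ = positive
    where
    positive : 0 < suc n * primorial n
    positive = *-mono-≤ {1} {suc n} (s≤s z≤n) (primorial>0 n)
  ... | no  _ = primorial>0 n

  smooth-∣ : ∀ s ps → All Prime ps → All (_≤ s) ps → product ps ∣ (s !) ^ length ps
  smooth-∣ s [] _ _ = ∣-refl
  smooth-∣ s (p ∷ ps) (pp ∷ pps) (p≤s ∷ ps≤s) =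
    *-pres-∣ (≤⇒∣! s (>-nonZero⁻¹ p {{prime⇒nonZero pp}}) p≤s) (smooth-∣ s ps pps ps≤s)

  prime≤product : ∀ {ps} → All Prime ps → All (_≤ product ps) ps
  prime≤product [] = []
  prime≤product {p ∷ ps} (pp ∷ pps) =
    m≤m*n p (product ps) {{productOfPrimes≢0 pps}} ∷
    Data.List.Relation.Unary.All.map (λ x≤ → ≤-trans x≤ (m≤n*m (product ps) p {{prime⇒nonZero pp}})) (prime≤product pps)

  2^length≤product : ∀ {ps} → All Prime ps → 2 ^ length ps ≤ product ps
  2^length≤product [] = ≤-refl
  2^length≤product (pp ∷ pps) = *-mono-≤ (nonTrivial⇒n>1 _ {{prime⇒nonTrivial pp}}) (2^length≤product pps)

  -- At most one prime factor of a number ≤ s² exceeds s.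
  factors-∣ : ∀ y s → (∀ p → Prime p → y < p → p ≤ s * s → ⊥) → ∀ ps → All Prime ps → product ps ≤ s * s →
              product ps ∣ primorial y * (s !) ^ length ps
  factors-∣ y s none [] _ _ = 1∣ _
  factors-∣ y s none (p ∷ ps) (pp ∷ pps) Π≤ with p ≤? s
  ... | yes p≤s = subst (p * product ps ∣_) (rearrange (s !) (primorial y) _)
          (*-pres-∣ (≤⇒∣! s (>-nonZero⁻¹ p {{prime⇒nonZero pp}}) p≤s)
            (factors-∣ y s none ps pps (≤-trans (m≤n*m (product ps) p {{prime⇒nonZero pp}}) Π≤)))
    where
    rearrange : ∀ f g h → f * (g * h) ≡ g * (f * h)
    rearrange = solve-∀
  ... | no  p≰s = *-pres-∣
          (prime∣primorial y pp (≮⇒≥ λ y<p → none p pp y<p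
             (≤-trans (m≤m*n p (product ps) {{productOfPrimes≢0 pps}}) Π≤)))
          (∣n⇒∣m*n (s !) (smooth-∣ s ps pps rest≤s))
    where
    rest≤s : All (_≤ s) ps
    rest≤s = Data.List.Relation.Unary.All.map
      (λ {x} x≤Π → ≮⇒≥ λ s<x → <⇒≱ (*-mono-< (≰⇒> p≰s) s<x) (≤-trans (*-monoʳ-≤ p x≤Π) Π≤))
      (prime≤product pps)

  !≤^ : ∀ s → s ! ≤ s ^ s
  !≤^ s = bounded s ≤-refl
    where
    bounded : ∀ n → n ≤ s → n ! ≤ s ^ n
    bounded zero _ = ≤-refl
    bounded (suc n) n<s = *-mono-≤ n<s (bounded n (<⇒≤ n<s))

  ^-monoʳ-∣ : ∀ m {a b} → a ≤ b → m ^ a ∣ m ^ b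
  ^-monoʳ-∣ m {a} {b} a≤b = subst (m ^ a ∣_)
    (trans (sym (^-distribˡ-+-* m a (b ∸ a))) (cong (m ^_) (m+[n∸m]≡n a≤b))) (m∣m*n (m ^ (b ∸ a)))

  2^-cancel-≤ : ∀ {a b} → 2 ^ a ≤ 2 ^ b → a ≤ b
  2^-cancel-≤ 2^a≤2^b = ≮⇒≥ λ b<a → <⇒≱ (^-monoʳ-< 2 ≤-refl b<a) 2^a≤2^b

  -- This is `(x + 8) * s * e < 12 * Y` of `∃prime′` after cancelling a common factor. The offsets
  -- make it start at 128 < 192; one step earlier it would read 98 < 96.
  square<2^ : ∀ x → 2 * ((x + 8) * (x + 8)) < 3 * 2 ^ (x + 6)
  square<2^ zero = ≤ᵇ⇒≤ 129 192 _
  square<2^ (suc x) = begin-strict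
    2 * ((suc x + 8) * (suc x + 8))                                    ≤⟨ m≤m+n _ _ ⟩
    2 * ((suc x + 8) * (suc x + 8)) + (2 * (x * x) + 28 * x + 94)      ≡⟨ rearrange x ⟩
    2 * (2 * ((x + 8) * (x + 8)))                                      <⟨ *-monoʳ-< 2 (square<2^ x) ⟩
    2 * (3 * 2 ^ (x + 6))                                              ≡⟨ commute (2 ^ (x + 6)) ⟩
    3 * (2 * 2 ^ (x + 6))                                              ∎
    where
    rearrange : ∀ x → 2 * ((suc x + 8) * (suc x + 8)) + (2 * (x * x) + 28 * x + 94) ≡ 2 * (2 * ((x + 8) * (x + 8)))
    rearrange = solve-∀
    commute : ∀ z → 2 * (3 * z) ≡ 3 * (2 * z)
    commute = solve-∀

  4^≡2^ : ∀ i → 4 ^ i ≡ 2 ^ (2 * i)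
  4^≡2^ i = ^-*-assoc 2 2 i

  4^≡2^*2^ : ∀ i → 4 ^ i ≡ 2 ^ i * 2 ^ i
  4^≡2^*2^ i = trans (4^≡2^ i) (trans (cong (λ z → 2 ^ (i + z)) (+-identityʳ i)) (^-distribˡ-+-* 2 i i))

  -- If there were no such prime, every j ≤ 4^(x+8) would divide R = primorial (4^(x+6)) * (s!)^e,
  -- which is too small to be divisible by the central entries of Leibniz' triangle.
  ∃prime′ : ∀ x → ∃[ p ] Prime p × 4 ^ (x + 6) < p × p ≤ 4 ^ (x + 8)
  ∃prime′ x with anyUpTo? (λ p → prime? p ×-dec (4 ^ (x + 6) <? p)) (suc (4 ^ (x + 8)))
  ... | yes (p , p<1+K , pp , y<p) = p , pp , y<p , ≤-pred p<1+K
  ... | no none = ⊥-elim (<⇒≱ R<4^7Y 4^7Y≤R)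
    where
    Y s e R : ℕ
    Y = 4 ^ (x + 6)
    -- `s * s` and `2 ^ e` both equal `4 ^ (x + 8)`: a positive `j` up to that bound has at most `e`
    -- prime factors, of which at most one exceeds `s`.
    s = 2 ^ (x + 8)
    e = 2 * (x + 8)
    R = primorial Y * (s !) ^ e
    s*s≡K : s * s ≡ 4 ^ (x + 8)
    s*s≡K = sym (4^≡2^*2^ (x + 8))
    16Y≡K : 16 * Y ≡ 4 ^ (x + 8)
    16Y≡K = begin-equality
      4 ^ 2 * 4 ^ (x + 6) ≡⟨ ^-distribˡ-+-* 4 2 (x + 6) ⟨
      4 ^ (2 + (x + 6))   ≡⟨ cong (4 ^_) (exponent x) ⟩
      4 ^ (x + 8)         ∎
      where
      exponent : ∀ x → 2 + (x + 6) ≡ x + 8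
      exponent = solve-∀
    no-prime : ∀ p → Prime p → Y < p → p ≤ s * s → ⊥
    no-prime p pp Y<p p≤ = none (p , s≤s (subst (p ≤_) s*s≡K p≤) , pp , Y<p)
    small∣R : ∀ j → 0 < j → j ≤ 4 ^ (x + 8) → j ∣ R
    small∣R j@(suc _) 0<j j≤K = subst (_∣ R) (sym isFactorisation)
      (∣-trans (factors-∣ Y s no-prime factors factorsPrime
                  (subst₂ _≤_ isFactorisation (sym s*s≡K) j≤K))
               (*-monoʳ-∣ (primorial Y) (^-monoʳ-∣ (s !) {length factors} {e} (2^-cancel-≤ {length factors} {e} (begin
                 2 ^ length factors ≤⟨ 2^length≤product factorsPrime ⟩
                 product factors    ≡⟨ isFactorisation ⟨
                 j                  ≤⟨ j≤K ⟩
                 4 ^ (x + 8)        ≡⟨ 4^≡2^ (x + 8) ⟩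
                 2 ^ e              ∎)))))
      where open PrimeFactorisation (factorise j)
    -- The 7 keeps the central entry below row `16 * Y = 4 ^ (x + 8)`. The budget `4 ^ (7 * Y)`
    -- splits into `4 ^ Y` for the primorial and `4 ^ (6 * Y)` for the power of `s !`.
    7Y+7Y<K : 7 * Y + 7 * Y < 4 ^ (x + 8)
    7Y+7Y<K = begin-strict
      7 * Y + 7 * Y  ≡⟨ *-distribʳ-+ Y 7 7 ⟨
      14 * Y         <⟨ *-monoˡ-< Y {{m^n≢0 4 (x + 6)}} (≤ᵇ⇒≤ 15 16 _) ⟩
      16 * Y         ≡⟨ 16Y≡K ⟩
      4 ^ (x + 8)    ∎
    R≢0 : NonZero R
    R≢0 = m*n≢0 _ _ {{>-nonZero (primorial>0 Y)}} {{m^n≢0 (s !) e {{s !≢0}}}}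
    4^7Y≤R : 4 ^ (7 * Y) ≤ R
    4^7Y≤R = begin
      4 ^ (7 * Y)                                      ≤⟨ 4^≤central (7 * Y) ⟩
      suc (2 * (7 * Y)) * central (7 * Y)              ≡⟨ cong (λ z → suc (7 * Y + z) * central (7 * Y)) (+-identityʳ (7 * Y)) ⟩
      suc (7 * Y + 7 * Y) * central (7 * Y)            ≤⟨ ∣⇒≤ {{R≢0}} (leibniz-∣ (4 ^ (x + 8)) R small∣R (7 * Y) (7 * Y) 7Y+7Y<K) ⟩
      R                                                ∎
    sse<12Y : (x + 8) * s * e < 12 * Y
    sse<12Y = begin-strict
      (x + 8) * s * e                                   ≡⟨ cong (λ z → (x + 8) * z * e) s≡4t ⟩
      (x + 8) * (4 * t) * (2 * (x + 8))                 ≡⟨ first (x + 8) t ⟩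
      4 * t * (2 * ((x + 8) * (x + 8)))                 <⟨ *-monoʳ-< (4 * t) {{m*n≢0 4 t {{_}} {{m^n≢0 2 (x + 6)}}}} (square<2^ x) ⟩
      4 * t * (3 * t)                                   ≡⟨ second t ⟩
      12 * (t * t)                                      ≡⟨ cong (12 *_) (4^≡2^*2^ (x + 6)) ⟨
      12 * Y                                            ∎
      where
      t : ℕ
      t = 2 ^ (x + 6)
      s≡4t : s ≡ 4 * t
      s≡4t = trans (cong (2 ^_) (exponent x)) (^-distribˡ-+-* 2 2 (x + 6))
        where
        exponent : ∀ x → x + 8 ≡ 2 + (x + 6)
        exponent = solve-∀
      first : ∀ a t → a * (4 * t) * (2 * a) ≡ 4 * t * (2 * (a * a))
      first = solve-∀
      second : ∀ t → 4 * t * (3 * t) ≡ 12 * (t * t)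
      second = solve-∀
    R<4^7Y : R < 4 ^ (7 * Y)
    R<4^7Y = begin-strict
      primorial Y * (s !) ^ e                 ≤⟨ *-mono-≤ primorial≤ (^-monoˡ-≤ e (!≤^ s)) ⟩
      4 ^ Y * (s ^ s) ^ e                     ≡⟨ cong (λ z → 4 ^ Y * z ^ e) (^-*-assoc 2 (x + 8) s) ⟩
      4 ^ Y * (2 ^ ((x + 8) * s)) ^ e         ≡⟨ cong (4 ^ Y *_) (^-*-assoc 2 ((x + 8) * s) e) ⟩
      4 ^ Y * 2 ^ ((x + 8) * s * e)           <⟨ *-monoʳ-< (4 ^ Y) {{m^n≢0 4 Y}} (^-monoʳ-< 2 ≤-refl sse<12Y) ⟩
      4 ^ Y * 2 ^ (12 * Y)                    ≡⟨ cong (λ z → 4 ^ Y * 2 ^ z) (*-assoc 2 6 Y) ⟩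
      4 ^ Y * 2 ^ (2 * (6 * Y))               ≡⟨ cong (4 ^ Y *_) (4^≡2^ (6 * Y)) ⟨
      4 ^ Y * 4 ^ (6 * Y)                     ≡⟨ ^-distribˡ-+-* 4 Y (6 * Y) ⟨
      4 ^ (Y + 6 * Y)                         ∎
      where
      primorial≤ : primorial Y ≤ 4 ^ Y
      primorial≤ = subst (λ z → primorial z ≤ 4 ^ z) (sym (4^≡2^ (x + 6))) (primorial-2^ (2 * (x + 6)))

  ∃prime : ∀ i → 6 ≤ i → ∃[ p ] Prime p × 4 ^ i < p × p ≤ 4 ^ (2 + i)
  ∃prime i 6≤i = subst (λ j → ∃[ p ] Prime p × 4 ^ j < p × p ≤ 4 ^ (2 + j)) (m∸n+n≡m 6≤i)
    (subst (λ j → ∃[ p ] Prime p × 4 ^ (i ∸ 6 + 6) < p × p ≤ 4 ^ j) (exponent (i ∸ 6)) (∃prime′ (i ∸ 6)))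
    where
    exponent : ∀ x → x + 8 ≡ 2 + (x + 6)
    exponent = solve-∀

-- Probability on colourings, expressed by sums over all vectors.

module Counting where

  open import Data.Nat
  open import Data.Nat.Properties
  open import Data.Nat.Tactic.RingSolver using (solve-∀)
  open import Data.Fin using (Fin; zero; suc)
  open import Data.Vec using (Vec; []; _∷_; _[_]≔_)
  open import Data.List using (List; []; _∷_; length; allFin)
  open import Data.List.Properties using (length-tabulate)
  open import Data.List.Membership.Propositional using (_∈_)
  open import Data.List.Relation.Unary.Any using (here; there)
  open import Data.List.Relation.Unary.All using (All; []; _∷_)
  open import Data.List.Relation.Unary.AllPairs using (AllPairs; []; _∷_)
  open import Data.Product using (_×_; _,_; proj₁; proj₂; ∃-syntax)
  open import Relation.Nullary
  open import Relation.Binary.PropositionalEquality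
  open import Function using (_∘_; id)

  open ≤-Reasoning

  private variable
    A B : Set
    P Q : Set
    c q : ℕ

  ∑ : List A → (A → ℕ) → ℕ
  ∑ []       g = 0
  ∑ (x ∷ xs) g = g x + ∑ xs g

  ∑-mono : ∀ (xs : List A) {g h : A → ℕ} → (∀ x → x ∈ xs → g x ≤ h x) → ∑ xs g ≤ ∑ xs h
  ∑-mono []       g≤h = z≤n
  ∑-mono (x ∷ xs) g≤h = +-mono-≤ (g≤h x (here refl)) (∑-mono xs (λ y → g≤h y ∘ there))

  ∑-cong : ∀ (xs : List A) {g h : A → ℕ} → (∀ x → g x ≡ h x) → ∑ xs g ≡ ∑ xs h
  ∑-cong []       g≡h = refl
  ∑-cong (x ∷ xs) g≡h = cong₂ _+_ (g≡h x) (∑-cong xs g≡h)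

  ∑-+ : ∀ (xs : List A) (g h : A → ℕ) → ∑ xs (λ x → g x + h x) ≡ ∑ xs g + ∑ xs h
  ∑-+ []       g h = refl
  ∑-+ (x ∷ xs) g h = trans (cong (g x + h x +_) (∑-+ xs g h)) (interchange (g x) (h x) _ _)
    where
    interchange : ∀ a b c d → a + b + (c + d) ≡ a + c + (b + d)
    interchange = solve-∀

  ∑-*ˡ : ∀ (xs : List A) m (g : A → ℕ) → ∑ xs (λ x → m * g x) ≡ m * ∑ xs g
  ∑-*ˡ []       m g = sym (*-zeroʳ m)
  ∑-*ˡ (x ∷ xs) m g = trans (cong (m * g x +_) (∑-*ˡ xs m g)) (sym (*-distribˡ-+ m (g x) (∑ xs g)))

  ∑-const : ∀ (xs : List A) m → ∑ xs (λ _ → m) ≡ length xs * m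
  ∑-const []       m = refl
  ∑-const (x ∷ xs) m = cong (m +_) (∑-const xs m)

  ∑-swap : ∀ (xs : List A) (ys : List B) (g : A → B → ℕ) →
           ∑ xs (λ x → ∑ ys (g x)) ≡ ∑ ys (λ y → ∑ xs (λ x → g x y))
  ∑-swap []       ys g = sym (trans (∑-const ys 0) (*-zeroʳ (length ys)))
  ∑-swap (x ∷ xs) ys g = trans (cong (∑ ys (g x) +_) (∑-swap xs ys g)) (sym (∑-+ ys (g x) _))

  ∈⇒≤∑ : ∀ {xs : List A} {x} (g : A → ℕ) → x ∈ xs → g x ≤ ∑ xs g
  ∈⇒≤∑ g (here refl)  = m≤m+n _ _
  ∈⇒≤∑ g (there x∈xs) = ≤-trans (∈⇒≤∑ g x∈xs) (m≤n+m _ _)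

  ∑-<⇒∃ : ∀ (xs : List A) {g h : A → ℕ} → ∑ xs g < ∑ xs h → ∃[ x ] g x < h x
  ∑-<⇒∃ []       ()
  ∑-<⇒∃ (x ∷ xs) {g} {h} ∑g<∑h with g x <? h x
  ... | yes gx<hx = x , gx<hx
  ... | no  gx≮hx = ∑-<⇒∃ xs (≰⇒> λ ∑h≤∑g → <⇒≱ ∑g<∑h (+-mono-≤ (≮⇒≥ gx≮hx) ∑h≤∑g))

  𝟙 : Dec P → ℕ
  𝟙 (yes _) = 1
  𝟙 (no _)  = 0

  𝟙-mono : (P? : Dec P) (Q? : Dec Q) → (P → Q) → 𝟙 P? ≤ 𝟙 Q?
  𝟙-mono (yes p) (yes _) P→Q = ≤-refl
  𝟙-mono (yes p) (no ¬q) P→Q = contradiction (P→Q p) ¬q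
  𝟙-mono (no _)  Q?      P→Q = z≤n

  𝟙-cong : (P? : Dec P) (Q? : Dec Q) → (P → Q) → (Q → P) → 𝟙 P? ≡ 𝟙 Q?
  𝟙-cong P? Q? P→Q Q→P = ≤-antisym (𝟙-mono P? Q? P→Q) (𝟙-mono Q? P? Q→P)

  𝟙-true : (P? : Dec P) → P → 1 ≤ 𝟙 P?
  𝟙-true P? p = 𝟙-mono (yes p) P? id

  ∑ᵛ : (Vec (Fin c) q → ℕ) → ℕ
  ∑ᵛ {q = zero}      g = g []
  ∑ᵛ {c} {q = suc q} g = ∑ (allFin c) λ x → ∑ᵛ (λ f → g (x ∷ f))

  ∑ᵛ-mono : {g h : Vec (Fin c) q → ℕ} → (∀ f → g f ≤ h f) → ∑ᵛ g ≤ ∑ᵛ h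
  ∑ᵛ-mono {q = zero}      g≤h = g≤h []
  ∑ᵛ-mono {c} {q = suc q} g≤h = ∑-mono (allFin c) λ x _ → ∑ᵛ-mono (λ f → g≤h (x ∷ f))

  ∑ᵛ-cong : {g h : Vec (Fin c) q → ℕ} → (∀ f → g f ≡ h f) → ∑ᵛ g ≡ ∑ᵛ h
  ∑ᵛ-cong g≡h = ≤-antisym (∑ᵛ-mono (≤-reflexive ∘ g≡h)) (∑ᵛ-mono (≤-reflexive ∘ sym ∘ g≡h))

  ∑ᵛ-*ˡ : ∀ m (g : Vec (Fin c) q → ℕ) → ∑ᵛ (λ f → m * g f) ≡ m * ∑ᵛ g
  ∑ᵛ-*ˡ {q = zero}      m g = refl
  ∑ᵛ-*ˡ {c} {q = suc q} m g =
    trans (∑-cong (allFin c) (λ x → ∑ᵛ-*ˡ m (λ f → g (x ∷ f)))) (∑-*ˡ (allFin c) m _)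

  ∑ᵛ-+ : (g h : Vec (Fin c) q → ℕ) → ∑ᵛ (λ f → g f + h f) ≡ ∑ᵛ g + ∑ᵛ h
  ∑ᵛ-+ {q = zero}      g h = refl
  ∑ᵛ-+ {c} {q = suc q} g h =
    trans (∑-cong (allFin c) (λ x → ∑ᵛ-+ (λ f → g (x ∷ f)) (λ f → h (x ∷ f)))) (∑-+ (allFin c) _ _)

  ∑ᵛ-∑ : ∀ (xs : List A) (g : A → Vec (Fin c) q → ℕ) →
         ∑ᵛ (λ f → ∑ xs (λ x → g x f)) ≡ ∑ xs (λ x → ∑ᵛ (g x))
  ∑ᵛ-∑ {q = zero}      xs g = refl
  ∑ᵛ-∑ {c = c} {q = suc q} xs g =
    trans (∑-cong (allFin c) (λ y → ∑ᵛ-∑ xs (λ x f → g x (y ∷ f)))) (∑-swap (allFin c) xs _)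

  length-allFin : ∀ n → length (allFin n) ≡ n
  length-allFin n = length-tabulate id

  ∑ᵛ-const : ∀ c q m → ∑ᵛ {c} {q} (λ _ → m) ≡ c ^ q * m
  ∑ᵛ-const c zero    m = sym (+-identityʳ m)
  ∑ᵛ-const c (suc q) m = begin-equality
    ∑ (allFin c) (λ _ → ∑ᵛ {c} {q} (λ _ → m))     ≡⟨ ∑-const (allFin c) _ ⟩
    length (allFin c) * ∑ᵛ {c} {q} (λ _ → m)      ≡⟨ cong₂ _*_ (length-allFin c) (∑ᵛ-const c q m) ⟩
    c * (c ^ q * m)                               ≡⟨ *-assoc c (c ^ q) m ⟨
    c * c ^ q * m                                 ∎

  ∑ᵛ-<⇒∃ : {g h : Vec (Fin c) q → ℕ} → ∑ᵛ g < ∑ᵛ h → ∃[ f ] g f < h f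
  ∑ᵛ-<⇒∃ {q = zero}      lt = [] , lt
  ∑ᵛ-<⇒∃ {c} {q = suc q} lt with ∑-<⇒∃ (allFin c) lt
  ... | x , lt′ with ∑ᵛ-<⇒∃ lt′
  ...   | f , lt″ = x ∷ f , lt″

  -- Overwriting coordinate `a` by every value in turn produces each vector exactly `c` times: the
  -- uniform distribution is invariant under resampling.
  resample : ∀ (a : Fin q) (g : Vec (Fin c) q → ℕ) →
             c * ∑ᵛ g ≡ ∑ᵛ (λ f → ∑ (allFin c) (λ x → g (f [ a ]≔ x)))
  resample {suc q} {c} zero g = begin-equality
    c * ∑ (allFin c) (λ x → ∑ᵛ (λ f → g (x ∷ f)))                          ≡⟨ cong (c *_) (∑ᵛ-∑ (allFin c) (λ x f → g (x ∷ f))) ⟨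
    c * ∑ᵛ (λ f → ∑ (allFin c) (λ x → g (x ∷ f)))                          ≡⟨ cong (_* ∑ᵛ (λ f → ∑ (allFin c) (λ x → g (x ∷ f)))) (length-allFin c) ⟨
    length (allFin c) * ∑ᵛ (λ f → ∑ (allFin c) (λ x → g (x ∷ f)))          ≡⟨ ∑-const (allFin c) _ ⟨
    ∑ (allFin c) (λ _ → ∑ᵛ (λ f → ∑ (allFin c) (λ x → g (x ∷ f))))         ∎
  resample {suc q} {c} (suc a) g = begin-equality
    c * ∑ (allFin c) (λ y → ∑ᵛ (λ f → g (y ∷ f)))                          ≡⟨ ∑-*ˡ (allFin c) c _ ⟨
    ∑ (allFin c) (λ y → c * ∑ᵛ (λ f → g (y ∷ f)))                          ≡⟨ ∑-cong (allFin c) (λ y → resample a (λ f → g (y ∷ f))) ⟩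
    ∑ (allFin c) (λ y → ∑ᵛ (λ f → ∑ (allFin c) (λ x → g (y ∷ f [ a ]≔ x)))) ∎

  Ignores : Fin q → (Vec (Fin c) q → ℕ) → Set
  Ignores a g = ∀ f x → g (f [ a ]≔ x) ≡ g f

  -- With the other coordinates fixed, `g` is constant in coordinate `a` and `h` averages at most
  -- `m / c` over it.
  resample-≤ : ∀ (a : Fin q) (g h : Vec (Fin c) q → ℕ) m → Ignores a g →
               (∀ f → ∑ (allFin c) (λ x → h (f [ a ]≔ x)) ≤ m) →
               c * ∑ᵛ (λ f → g f * h f) ≤ m * ∑ᵛ g
  resample-≤ {c = c} a g h m g-ign ∑h≤m = begin
    c * ∑ᵛ (λ f → g f * h f)                                             ≡⟨ resample a (λ f → g f * h f) ⟩
    ∑ᵛ (λ f → ∑ (allFin c) (λ x → g (f [ a ]≔ x) * h (f [ a ]≔ x)))      ≡⟨ ∑ᵛ-cong (λ f → ∑-cong (allFin c) (λ x → cong (_* h (f [ a ]≔ x)) (g-ign f x))) ⟩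
    ∑ᵛ (λ f → ∑ (allFin c) (λ x → g f * h (f [ a ]≔ x)))                 ≡⟨ ∑ᵛ-cong (λ f → ∑-*ˡ (allFin c) (g f) (λ x → h (f [ a ]≔ x))) ⟩
    ∑ᵛ (λ f → g f * ∑ (allFin c) (λ x → h (f [ a ]≔ x)))                 ≤⟨ ∑ᵛ-mono (λ f → *-monoʳ-≤ (g f) (∑h≤m f)) ⟩
    ∑ᵛ (λ f → g f * m)                                                   ≡⟨ ∑ᵛ-cong (λ f → *-comm (g f) m) ⟩
    ∑ᵛ (λ f → m * g f)                                                   ≡⟨ ∑ᵛ-*ˡ m g ⟩
    m * ∑ᵛ g                                                             ∎

  -- The index names the coordinate whose resampling bounds the test; the function may depend on
  -- further coordinates.
  Test : ℕ → ℕ → Set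
  Test c q = Fin q × (Vec (Fin c) q → ℕ)

  ∏ : List (Test c q) → Vec (Fin c) q → ℕ
  ∏ []             f = 1
  ∏ ((_ , h) ∷ ts) f = h f * ∏ ts f

  ∏-ignores : ∀ {a : Fin q} {ts : List (Test c q)} → All (λ t → Ignores a (proj₂ t)) ts → Ignores a (∏ ts)
  ∏-ignores []           f x = refl
  ∏-ignores (ign ∷ igns) f x = cong₂ _*_ (ign f x) (∏-ignores igns f x)

  ∏-positive : ∀ {ts : List (Test c q)} {f} → All (λ t → 1 ≤ proj₂ t f) ts → 1 ≤ ∏ ts f
  ∏-positive []           = ≤-refl
  ∏-positive (1≤h ∷ 1≤hs) = *-mono-≤ 1≤h (∏-positive 1≤hs)

  -- The tests behave like independent events of probability at most m / c.
  independent-tests : ∀ m (g : Vec (Fin c) q → ℕ) (ts : List (Test c q)) →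
    All (λ t → Ignores (proj₁ t) g) ts →
    AllPairs (λ t t′ → Ignores (proj₁ t) (proj₂ t′)) ts →
    All (λ t → ∀ f → ∑ (allFin c) (λ x → proj₂ t (f [ proj₁ t ]≔ x)) ≤ m) ts →
    c ^ length ts * ∑ᵛ (λ f → g f * ∏ ts f) ≤ m ^ length ts * ∑ᵛ g
  independent-tests m g [] _ _ _ = ≤-reflexive (cong (1 *_) (∑ᵛ-cong (λ f → *-identityʳ (g f))))
  independent-tests {c} m g ((a , h) ∷ ts) (g-ign ∷ g-igns) (h-ign ∷ h-igns) (h≤ ∷ hs≤) = begin
    c * c ^ l * ∑ᵛ (λ f → g f * (h f * ∏ ts f))       ≡⟨ rearrange c (c ^ l) _ ⟩
    c ^ l * (c * ∑ᵛ (λ f → g f * (h f * ∏ ts f)))     ≡⟨ cong (λ z → c ^ l * (c * z)) (∑ᵛ-cong (λ f → commute (g f) (h f) (∏ ts f))) ⟩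
    -- Coordinate `a` is ignored by `g` and by all later tests, so the first test averages out with
    -- these held fixed. Independence in this triangular order is enough.
    c ^ l * (c * ∑ᵛ (λ f → g f * ∏ ts f * h f))       ≤⟨ *-monoʳ-≤ (c ^ l) (resample-≤ a (λ f → g f * ∏ ts f) h m
                                                            (λ f x → cong₂ _*_ (g-ign f x) (∏-ignores h-ign f x)) h≤) ⟩
    c ^ l * (m * ∑ᵛ (λ f → g f * ∏ ts f))             ≡⟨ rearrange′ (c ^ l) m _ ⟩
    m * (c ^ l * ∑ᵛ (λ f → g f * ∏ ts f))             ≤⟨ *-monoʳ-≤ m (independent-tests m g ts g-igns h-igns hs≤) ⟩
    m * (m ^ l * ∑ᵛ g)                                ≡⟨ *-assoc m (m ^ l) _ ⟨
    m * m ^ l * ∑ᵛ g                                  ∎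
    where
    l : ℕ
    l = length ts
    rearrange : ∀ x y z → x * y * z ≡ y * (x * z)
    rearrange = solve-∀
    rearrange′ : ∀ x y z → x * (y * z) ≡ y * (x * z)
    rearrange′ = solve-∀
    commute : ∀ x y z → x * (y * z) ≡ x * z * y
    commute = solve-∀

-- Rosenfeld's counting form of the local lemma.

module Rosenfeld where

  open Counting
  open import Data.Nat
  open import Data.Nat.Properties
  open import Data.Nat.Tactic.RingSolver using (solve-∀)
  open import Data.Nat.Induction using (<-rec)
  open import Data.Fin using (Fin; zero; suc)
  import Data.Fin.Properties as Fin
  open import Data.Fin.Subset using (Subset; _─_; _-_; ⊤; ∣_∣; inside; outside; ⁅_⁆)
    renaming (_∈_ to _∈ˢ_; _∉_ to _∉ˢ_; _⊆_ to _⊆ˢ_)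
  open import Data.Fin.Subset.Properties using (_∈?_; x∈p∧x≢y⇒x∈p-y; x∈p⇒∣p-x∣<∣p∣; p─q⊆p; ∣p─q∣≤∣p∣; x∈⁅x⁆; ∈⊤)
  open import Data.Vec using (Vec; []; _∷_; lookup; _[_]≔_; here; there)
  open import Data.Vec.Properties using (lookup∘update; lookup∘update′)
  open import Data.List using (List; []; _∷_; length; allFin; map; foldr)
  open import Data.List.Properties using (length-map)
  open import Data.List.Membership.Propositional using (_∈_; find)
  open import Data.List.Membership.Propositional.Properties using (∈-allFin)
  import Data.List.Relation.Unary.Any as Any
  open import Data.List.Relation.Unary.All as All using (All; []; _∷_; all?)
  open import Data.List.Relation.Unary.All.Properties using (¬All⇒Any¬) renaming (map⁺ to All-map⁺)
  open import Data.List.Relation.Unary.AllPairs using (AllPairs; []; _∷_)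
  open import Data.List.Relation.Unary.AllPairs.Properties renaming (map⁺ to AllPairs-map⁺)
  open import Data.List.Relation.Unary.Unique.Propositional using (Unique)
  open import Data.Product using (_×_; _,_; proj₁; proj₂; ∃-syntax)
  open import Relation.Nullary
  open import Relation.Nullary.Decidable using (¬?; _×-dec_; decidable-stable)
  open import Relation.Binary.PropositionalEquality
  open import Function using (_∘_)

  open ≤-Reasoning

  private variable
    c q : ℕ

  -- Bernoulli's inequality for `(1 - 1 / (1 + u)) ^ j`, with denominators cleared.
  bernoulli : ∀ u j → suc u * u ^ j + j * suc u ^ j ≥ suc u * suc u ^ j
  bernoulli u zero = ≤-reflexive (sym (+-identityʳ _))
  bernoulli u (suc j) = begin
    suc u * (suc u * t)                                 ≤⟨ *-monoʳ-≤ (suc u) (bernoulli u j) ⟩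
    suc u * (suc u * s + j * t)                         ≡⟨ split u s t j ⟩
    (suc u * (u * s) + j * (suc u * t)) + suc u * s     ≤⟨ +-monoʳ-≤ (suc u * (u * s) + j * (suc u * t)) (*-monoʳ-≤ (suc u) (^-monoˡ-≤ j (n≤1+n u))) ⟩
    (suc u * (u * s) + j * (suc u * t)) + suc u * t     ≡⟨ merge u s t j ⟩
    suc u * (u * s) + suc j * (suc u * t)               ∎
    where
    s t : ℕ
    s = u ^ j
    t = suc u ^ j
    split : ∀ u s t j → suc u * (suc u * s + j * t) ≡ (suc u * (u * s) + j * (suc u * t)) + suc u * s
    split = solve-∀
    merge : ∀ u s t j → (suc u * (u * s) + j * (suc u * t)) + suc u * t ≡ suc u * (u * s) + suc j * (suc u * t)
    merge = solve-∀

  -- Bernoulli with `j = k`: the quantity `(1 - 1 / 2k) ^ k` is at least `1 - k / 2k`.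
  halving : ∀ k u → suc u ≡ k + k → suc u ^ k ≤ 2 * u ^ k
  halving (suc κ) u 1+u≡2k = *-cancelˡ-≤ k (+-cancelʳ-≤ (k * t) _ _ (begin
    k * t + k * t           ≡⟨ *-distribʳ-+ t k k ⟨
    (k + k) * t             ≡⟨ cong (_* t) 1+u≡2k ⟨
    suc u * t               ≤⟨ bernoulli u k ⟩
    suc u * s + k * t       ≡⟨ cong (λ z → z * s + k * t) 1+u≡2k ⟩
    (k + k) * s + k * t     ≡⟨ cong (_+ k * t) (rearrange k s) ⟩
    k * (2 * s) + k * t     ∎))
    where
    k s t : ℕ
    k = suc κ
    s = u ^ k
    t = suc u ^ k
    rearrange : ∀ k s → (k + k) * s ≡ k * (2 * s)
    rearrange = solve-∀

  -- After division by `C`, the loss `x - y` is at most `2 * l * x / C`, hence at most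
  -- `x / (1 + u)`.
  absorb : ∀ C u x y l .{{_ : NonZero C}} → C * x ≤ C * y + l * (2 * x) → 2 * suc u * l ≤ C →
           u * x ≤ suc u * y
  absorb C u x y l loss small = *-cancelˡ-≤ C (+-cancelˡ-≤ (C * x) _ _ (begin
    C * x + C * (u * x)                   ≡⟨ gather C u x ⟩
    suc u * (C * x)                       ≤⟨ *-monoʳ-≤ (suc u) loss ⟩
    suc u * (C * y + l * (2 * x))         ≡⟨ spread (suc u) C y l x ⟩
    2 * suc u * l * x + C * (suc u * y)   ≤⟨ +-monoˡ-≤ (C * (suc u * y)) (*-monoˡ-≤ x small) ⟩
    C * x + C * (suc u * y)               ∎))
    where
    gather : ∀ C u x → C * x + C * (u * x) ≡ suc u * (C * x)
    gather = solve-∀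
    spread : ∀ s C y l x → s * (C * y + l * (2 * x)) ≡ 2 * s * l * x + C * (s * y)
    spread = solve-∀

  x∈p─q⇒x∉q : ∀ (p q′ : Subset q) {x} → x ∈ˢ p ─ q′ → x ∉ˢ q′
  x∈p─q⇒x∉q (_ ∷ p) (outside ∷ q) (there x∈p─q) (there x∈q) = x∈p─q⇒x∉q p q x∈p─q x∈q
  x∈p─q⇒x∉q (_ ∷ p) (inside ∷ q)  (there x∈p─q) (there x∈q) = x∈p─q⇒x∉q p q x∈p─q x∈q

  x∉p-x : ∀ (p : Subset q) x → x ∉ˢ p - x
  x∉p-x p x x∈p-x = x∈p─q⇒x∉q p ⁅ x ⁆ x∈p-x (x∈⁅x⁆ x)

  remove : Subset q → List (Fin q) → Subset q
  remove = foldr (λ a X → X - a)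

  remove-⊆ : ∀ (X : Subset q) e → remove X e ⊆ˢ X
  remove-⊆ X []      x∈ = x∈
  remove-⊆ X (a ∷ e) x∈ = remove-⊆ X e (p─q⊆p (remove X e) ⁅ a ⁆ x∈)

  ∣remove∣ : ∀ (X : Subset q) e → ∣ remove X e ∣ ≤ ∣ X ∣
  ∣remove∣ X []      = ≤-refl
  ∣remove∣ X (a ∷ e) = ≤-trans (∣p─q∣≤∣p∣ (remove X e) ⁅ a ⁆) (∣remove∣ X e)

  ∉remove : ∀ (X : Subset q) {e a} → a ∈ e → a ∉ˢ remove X e
  ∉remove X {b ∷ e} (Any.here refl) a∈ = x∉p-x (remove X e) b a∈
  ∉remove X {b ∷ e} (Any.there a∈e) a∈ = ∉remove X a∈e (p─q⊆p (remove X e) ⁅ b ⁆ a∈)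

  Mono : Vec (Fin c) q → List (Fin q) → Set
  Mono f e = All (λ u → All (λ v → lookup f u ≡ lookup f v) e) e

  mono? : (f : Vec (Fin c) q) → ∀ e → Dec (Mono f e)
  mono? f e = all? (λ u → all? (λ v → lookup f u Fin.≟ lookup f v) e) e

  mono-resp : ∀ {f g : Vec (Fin c) q} {e} → (∀ {w} → w ∈ e → lookup g w ≡ lookup f w) → Mono f e → Mono g e
  mono-resp g≡f mono = All.tabulate λ u∈e → All.tabulate λ v∈e →
    trans (g≡f u∈e) (trans (All.lookup (All.lookup mono u∈e) v∈e) (sym (g≡f v∈e)))

  ∑-𝟙-≟ : ∀ n (w : Fin n) → ∑ (allFin n) (λ x → 𝟙 (x Fin.≟ w)) ≤ 1
  ∑-𝟙-≟ n w = go (allFin n) (allFin-unique n)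
    where
    open import Data.List.Relation.Unary.Unique.Propositional.Properties renaming (allFin⁺ to allFin-unique)
    vanish : ∀ {xs} → All (w ≢_) xs → ∑ xs (λ x → 𝟙 (x Fin.≟ w)) ≡ 0
    vanish [] = refl
    vanish {x ∷ xs} (w≢x ∷ ≢s) with x Fin.≟ w
    ... | yes x≡w = contradiction (sym x≡w) w≢x
    ... | no _    = vanish ≢s
    go : ∀ xs → Unique xs → ∑ xs (λ x → 𝟙 (x Fin.≟ w)) ≤ 1
    go [] _ = z≤n
    go (x ∷ xs) (≢s ∷ uniq) with x Fin.≟ w
    ... | no _     = go xs uniq
    ... | yes refl = ≤-reflexive (cong suc (vanish ≢s))

  -- The edge `a ∷ e` is monochromatic when all further vertices agree with `a`. For a vertex `u`
  -- other than `a`, resampling `u` gives agreement with probability `1 / c`.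
  sameTests : Fin q → List (Fin q) → List (Test c q)
  sameTests a = map (λ u → u , λ f → 𝟙 (lookup f u Fin.≟ lookup f a))

  -- The edges in E need not have bounded degree; it suffices that every edge through v contains
  -- one of the edges listed in D v.
  module LocalLemma
    (c q κ u : ℕ) .{{_ : NonZero c}} (1+u≡2k : suc u ≡ suc κ + suc κ)
    (E : List (List (Fin q))) (inhabited : ∀ {e} → e ∈ E → ∃[ v ] v ∈ e)
    (D : Fin q → List (List (Fin q)))
    (cover : ∀ {e v} → e ∈ E → v ∈ e → ∃[ e′ ] e′ ∈ D v × All (_∈ e) e′)
    (uniform : ∀ {v e} → e ∈ D v → Unique e × length e ≡ suc κ)
    (degree : ∀ v → 2 * suc u * length (D v) ≤ c ^ κ)
    where

    -- `f` always colours all `q` points; `X` only selects the edges that count. All counts thus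
    -- live in one sample space, where adding a point costs a proportion instead of gaining a factor
    -- of about `c`.
    Valid : Subset q → Vec (Fin c) q → Set
    Valid X f = All (λ e → ¬ (All (_∈ˢ X) e × Mono f e)) E

    valid? : ∀ X f → Dec (Valid X f)
    valid? X f = all? (λ e → ¬? (all? (_∈? X) e ×-dec mono? f e)) E

    valid-anti : ∀ {X Y} {f} → X ⊆ˢ Y → Valid Y f → Valid X f
    valid-anti X⊆Y = All.map (λ ok (e⊆X , mono) → ok (All.map X⊆Y e⊆X , mono))

    # : Subset q → ℕ
    # X = ∑ᵛ (λ f → 𝟙 (valid? X f))

    #-anti : ∀ {X Y} → X ⊆ˢ Y → # Y ≤ # X
    #-anti {X} {Y} X⊆Y = ∑ᵛ-mono (λ f → 𝟙-mono (valid? Y f) (valid? X f) (valid-anti {f = f} X⊆Y))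

    -- Rosenfeld's invariant: adding a point to Y - a keeps a proportion u / (1 + u) = 1 - 1 / 2k of the
    -- valid colourings.  Adding the k points of an edge therefore loses a factor 2 at most.
    Shrinks : Subset q → Set
    Shrinks Y = ∀ a → a ∈ˢ Y → u * # (Y - a) ≤ suc u * # Y

    shrink-any : ∀ {Y} → Shrinks Y → ∀ a → u * # (Y - a) ≤ suc u * # Y
    shrink-any {Y} shr a with a ∈? Y
    ... | yes a∈Y = shr a a∈Y
    ... | no  a∉Y = *-mono-≤ (n≤1+n u) (#-anti (λ x∈Y → x∈p∧x≢y⇒x∈p-y x∈Y λ { refl → a∉Y x∈Y }))

    #-remove : ∀ X → (∀ Y → ∣ Y ∣ ≤ ∣ X ∣ → Shrinks Y) →
               ∀ e → u ^ length e * # (remove X e) ≤ suc u ^ length e * # X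
    #-remove X shr [] = ≤-refl
    #-remove X shr (a ∷ e) = begin
      u * u ^ l * # (remove X e - a)         ≡⟨ rearrange u (u ^ l) _ ⟩
      u ^ l * (u * # (remove X e - a))       ≤⟨ *-monoʳ-≤ (u ^ l) (shrink-any (shr (remove X e) (∣remove∣ X e)) a) ⟩
      u ^ l * (suc u * # (remove X e))       ≡⟨ rearrange′ (u ^ l) (suc u) _ ⟩
      suc u * (u ^ l * # (remove X e))       ≤⟨ *-monoʳ-≤ (suc u) (#-remove X shr e) ⟩
      suc u * (suc u ^ l * # X)              ≡⟨ *-assoc (suc u) (suc u ^ l) _ ⟨
      suc u * suc u ^ l * # X                ∎
      where
      l : ℕ
      l = length e
      rearrange : ∀ x y z → x * y * z ≡ y * (x * z)
      rearrange = solve-∀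
      rearrange′ : ∀ x y z → x * (y * z) ≡ y * (x * z)
      rearrange′ = solve-∀

    u≢0 : NonZero u
    u≢0 = >-nonZero (subst (0 <_) (sym (trans (cong pred 1+u≡2k) (+-suc κ κ))) z<s)

    #-remove-edge : ∀ X → (∀ Y → ∣ Y ∣ ≤ ∣ X ∣ → Shrinks Y) →
                    ∀ e → length e ≡ suc κ → # (remove X e) ≤ 2 * # X
    #-remove-edge X shr e ∣e∣≡k = *-cancelˡ-≤ (u ^ k) {{m^n≢0 u k {{u≢0}}}} (begin
      u ^ k * # (remove X e)       ≤⟨ subst (λ l → u ^ l * # (remove X e) ≤ suc u ^ l * # X) ∣e∣≡k (#-remove X shr e) ⟩
      suc u ^ k * # X              ≤⟨ *-monoˡ-≤ (# X) (halving k u 1+u≡2k) ⟩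
      2 * u ^ k * # X              ≡⟨ rearrange (u ^ k) (# X) ⟩
      u ^ k * (2 * # X)            ∎)
      where
      k : ℕ
      k = suc κ
      rearrange : ∀ x y → 2 * x * y ≡ x * (2 * y)
      rearrange = solve-∀

    valid-ignores : ∀ {X a} → a ∉ˢ X → Ignores a (λ f → 𝟙 (valid? X f))
    valid-ignores {X} {a} a∉X f x = 𝟙-cong (valid? X (f [ a ]≔ x)) (valid? X f)
      (All.map (λ ok (e⊆X , mono) → ok (e⊆X , mono-resp {f = f} {f [ a ]≔ x} (unchanged e⊆X) mono)))
      (All.map (λ ok (e⊆X , mono) → ok (e⊆X , mono-resp {f = f [ a ]≔ x} {f} (sym ∘ unchanged e⊆X) mono)))
      where
      unchanged : ∀ {e w} → All (_∈ˢ X) e → w ∈ e → lookup (f [ a ]≔ x) w ≡ lookup f w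
      unchanged e⊆X w∈e = lookup∘update′ (λ { refl → a∉X (All.lookup e⊆X w∈e) }) f x

    monoTests : List (Fin q) → List (Test c q)
    monoTests []      = []
    monoTests (a ∷ e) = sameTests a e

    mono⇒∏ : ∀ f e → Mono f e → 1 ≤ ∏ (monoTests e) f
    mono⇒∏ f []      mono = ≤-refl
    mono⇒∏ f (a ∷ e) mono = ∏-positive (All-map⁺ (All.map (λ {v} same → 𝟙-true (lookup f v Fin.≟ lookup f a) (All.head same)) (All.tail mono)))

    -- The whole edge has been removed, so validity does not see its colours; the `κ` vertices after
    -- the first then agree with it with probability `1 / c` each.
    mono-rare : ∀ X e → Unique e → length e ≡ suc κ →
                c ^ κ * ∑ᵛ (λ f → 𝟙 (valid? (remove X e) f) * ∏ (monoTests e) f) ≤ # (remove X e)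
    mono-rare X (a ∷ e) (a≢ ∷ e!) ∣e∣≡k = begin
      c ^ κ * T                            ≡⟨ cong (λ l → c ^ l * T) ∣ts∣≡κ ⟨
      c ^ length ts * T                    ≤⟨ independent-tests 1 _ ts
                                                (All-map⁺ (All.tabulate λ v∈e → valid-ignores {remove X (a ∷ e)} (∉remove X (Any.there v∈e))))
                                                (AllPairs-map⁺ (ignore-earlier e a≢ e!))
                                                (All-map⁺ (All.map one a≢)) ⟩
      1 ^ length ts * # (remove X (a ∷ e)) ≡⟨ cong (_* # (remove X (a ∷ e))) (^-zeroˡ (length ts)) ⟩
      1 * # (remove X (a ∷ e))             ≡⟨ *-identityˡ _ ⟩
      # (remove X (a ∷ e))                 ∎
      where
      ts : List (Test c q)
      ts = sameTests a e
      T : ℕ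
      T = ∑ᵛ (λ f → 𝟙 (valid? (remove X (a ∷ e)) f) * ∏ ts f)
      ∣ts∣≡κ : length ts ≡ κ
      ∣ts∣≡κ = trans (length-map _ e) (suc-injective ∣e∣≡k)
      same : Fin q → Vec (Fin c) q → ℕ
      same v f = 𝟙 (lookup f v Fin.≟ lookup f a)
      ignore-earlier : ∀ e → All (a ≢_) e → Unique e → AllPairs (λ v w → Ignores v (same w)) e
      ignore-earlier [] _ _ = []
      ignore-earlier (v ∷ e) (a≢v ∷ a≢) (v≢ ∷ e!) =
        All.map (λ v≢w f x → cong₂ (λ y z → 𝟙 (y Fin.≟ z)) (lookup∘update′ (v≢w ∘ sym) f x) (lookup∘update′ a≢v f x)) v≢
        ∷ ignore-earlier e a≢ e!
      one : ∀ {v} → a ≢ v → ∀ f → ∑ (allFin c) (λ x → same v (f [ v ]≔ x)) ≤ 1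
      one {v} a≢v f = subst (_≤ 1)
        (∑-cong (allFin c) (λ x → sym (cong₂ (λ y z → 𝟙 (y Fin.≟ z)) (lookup∘update v f x) (lookup∘update′ a≢v f x))))
        (∑-𝟙-≟ c (lookup f a))

    lost : Subset q → Vec (Fin c) q → List (Fin q) → ℕ
    lost X f e = 𝟙 (valid? (remove X e) f) * ∏ (monoTests e) f

    -- A colouring spoiled by adding `a` has a monochromatic edge through `a`, hence a monochromatic
    -- `e′` from `D a` inside it. Passing to `remove (Y - a) e′` weakens validity just enough to
    -- make it independent of the colours on `e′`.
    valid-add : ∀ Y a f → 𝟙 (valid? (Y - a) f) ≤ 𝟙 (valid? Y f) + ∑ (D a) (lost (Y - a) f)
    valid-add Y a f with valid? (Y - a) f
    ... | no _ = z≤n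
    ... | yes valid with valid? Y f
    ...   | yes _ = s≤s z≤n
    ...   | no ¬valid with find (¬All⇒Any¬ (λ e → ¬? (all? (_∈? Y) e ×-dec mono? f e)) E ¬valid)
    ...     | e , e∈E , ¬ok with decidable-stable (all? (_∈? Y) e ×-dec mono? f e) ¬ok
    ...       | e⊆Y , mono with Any.any? (a Fin.≟_) e
    ...         | no a∉e = contradiction
                    (All.tabulate (λ x∈e → x∈p∧x≢y⇒x∈p-y (All.lookup e⊆Y x∈e) λ { refl → a∉e x∈e }) , mono)
                    (All.lookup valid e∈E)
    ...         | yes a∈e with cover e∈E a∈e
    ...           | e′ , e′∈D , e′⊆e = ≤-trans
                    (*-mono-≤ (𝟙-true (valid? (remove (Y - a) e′) f) (valid-anti {f = f} (remove-⊆ (Y - a) e′) valid))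
                              (mono⇒∏ f e′ (All.map (λ u∈e → All.map (λ v∈e → All.lookup (All.lookup mono u∈e) v∈e) e′⊆e) e′⊆e)))
                    (∈⇒≤∑ (lost (Y - a) f) e′∈D)

    -- Strong induction on the size of `Y`. Each edge in `D a` spoils at most `2 * # X / c ^ κ`
    -- colourings, the 2 being the price of removing its points under the induction hypothesis;
    -- `degree` keeps the sum within `# X / (1 + u)`.
    shrinks : ∀ n Y → ∣ Y ∣ ≡ n → Shrinks Y
    shrinks = <-rec _ λ n rec Y ∣Y∣≡n a a∈Y →
      let
        X = Y - a
        smaller : ∀ Z → ∣ Z ∣ ≤ ∣ X ∣ → Shrinks Z
        smaller Z ∣Z∣≤∣X∣ = rec (subst (∣ Z ∣ <_) ∣Y∣≡n (≤-<-trans ∣Z∣≤∣X∣ (x∈p⇒∣p-x∣<∣p∣ a∈Y))) Z refl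
        C = c ^ κ
        rare : ∀ e → e ∈ D a → C * ∑ᵛ (λ f → lost X f e) ≤ 2 * # X
        rare e e∈D = ≤-trans (mono-rare X e (proj₁ (uniform e∈D)) (proj₂ (uniform e∈D)))
                             (#-remove-edge X smaller e (proj₂ (uniform e∈D)))
        loss : C * # X ≤ C * # Y + length (D a) * (2 * # X)
        loss = begin
          C * # X
            ≤⟨ *-monoʳ-≤ C (∑ᵛ-mono (valid-add Y a)) ⟩
          C * ∑ᵛ (λ f → 𝟙 (valid? Y f) + ∑ (D a) (lost X f))
            ≡⟨ cong (C *_) (trans (∑ᵛ-+ (λ f → 𝟙 (valid? Y f)) (λ f → ∑ (D a) (lost X f)))
                                  (cong (# Y +_) (∑ᵛ-∑ (D a) (λ e f → lost X f e)))) ⟩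
          C * (# Y + ∑ (D a) (λ e → ∑ᵛ (λ f → lost X f e)))
            ≡⟨ trans (*-distribˡ-+ C (# Y) _) (cong (C * # Y +_) (sym (∑-*ˡ (D a) C _))) ⟩
          C * # Y + ∑ (D a) (λ e → C * ∑ᵛ (λ f → lost X f e))
            ≤⟨ +-monoʳ-≤ (C * # Y) (∑-mono (D a) rare) ⟩
          C * # Y + ∑ (D a) (λ _ → 2 * # X)
            ≡⟨ cong (C * # Y +_) (∑-const (D a) _) ⟩
          C * # Y + length (D a) * (2 * # X) ∎
      in absorb C u (# X) (# Y) (length (D a)) {{m^n≢0 c κ}} loss (degree a)

    -- With every point removed no edge survives, as each has a point, so all `c ^ q` colourings are
    -- valid. Putting the points back one by one keeps a positive proportion each time.
    #⊤-positive : 0 < # ⊤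
    #⊤-positive = n≢0⇒n>0 λ #≡0 → <⇒≱ 1≤
      (≤-reflexive (trans (cong (suc u ^ length (allFin q) *_) #≡0) (*-zeroʳ (suc u ^ length (allFin q)))))
      where
      none-valid : ∀ f → Valid (remove ⊤ (allFin q)) f
      none-valid f = All.tabulate λ e∈E (e⊆ , _) → let (v , v∈e) = inhabited e∈E in
        ∉remove ⊤ (∈-allFin v) (All.lookup e⊆ v∈e)
      1≤#all : 1 ≤ # (remove ⊤ (allFin q))
      1≤#all = begin
        1                                          ≤⟨ m^n>0 c q ⟩
        c ^ q                                      ≡⟨ *-identityʳ (c ^ q) ⟨
        c ^ q * 1                                  ≡⟨ ∑ᵛ-const c q 1 ⟨
        ∑ᵛ {c} {q} (λ _ → 1)                       ≤⟨ ∑ᵛ-mono (λ f → 𝟙-true (valid? (remove ⊤ (allFin q)) f) (none-valid f)) ⟩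
        # (remove ⊤ (allFin q))                    ∎
      1≤ : 1 ≤ suc u ^ length (allFin q) * # ⊤
      1≤ = ≤-trans (*-mono-≤ (m^n>0 u {{u≢0}} (length (allFin q))) 1≤#all)
                   (#-remove ⊤ (λ Y _ → shrinks ∣ Y ∣ Y refl) (allFin q))

    valid-⊤ : ∀ f → 0 < 𝟙 (valid? ⊤ f) → Valid ⊤ f
    valid-⊤ f 0<𝟙 with valid? ⊤ f
    ... | yes valid = valid

    ∃valid : ∃[ f ] ∀ {e} → e ∈ E → ¬ Mono f e
    ∃valid =
      let f , 0<𝟙 = ∑ᵛ-<⇒∃ {g = λ _ → 0} {h = λ f → 𝟙 (valid? ⊤ f)}
                      (subst (_< # ⊤) (sym (trans (∑ᵛ-const c q 0) (*-zeroʳ (c ^ q)))) #⊤-positive)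
      in f , λ e∈E mono → All.lookup (valid-⊤ f 0<𝟙) e∈E (All.tabulate (λ _ → ∈⊤) , mono)

-- Colourings of a cyclic group and the random selector.

module Cyclic where

  open Counting
  open Rosenfeld
  open import Data.Nat
  open import Data.Nat.Properties
  open import Data.Nat.Divisibility
  open import Data.Nat.DivMod
  open import Data.Nat.Primality
  open import Data.Nat.Tactic.RingSolver using (solve-∀)
  open import Data.Fin using (Fin; zero; suc; toℕ)
  import Data.Fin.Properties as Fin
  open import Data.Vec using (Vec; []; _∷_; lookup; _[_]≔_)
  open import Data.Vec.Properties using (lookup∘update; lookup∘update′)
  open import Data.List using (List; []; _∷_; length; allFin; map; upTo; applyUpTo; cartesianProductWith)
  open import Data.List.Properties using (length-map; length-++; length-applyUpTo; length-upTo)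
  open import Data.List.Membership.Propositional using (_∈_)
  open import Data.List.Membership.Propositional.Properties
    using (∈-applyUpTo⁺; ∈-applyUpTo⁻; ∈-upTo⁺; ∈-upTo⁻; ∈-cartesianProductWith⁺; ∈-cartesianProductWith⁻)
  open import Data.List.Relation.Unary.All as All using (All; []; _∷_)
  open import Data.List.Relation.Unary.All.Properties using () renaming (applyUpTo⁺₁ to All-applyUpTo⁺; applyUpTo⁺₂ to All-applyUpTo⁺₂)
  open import Data.List.Relation.Unary.AllPairs.Properties using () renaming (applyUpTo⁺₁ to AllPairs-applyUpTo⁺)
  open import Data.List.Relation.Unary.Unique.Propositional using (Unique)
  open import Data.List.Relation.Unary.Unique.Propositional.Properties using () renaming (applyUpTo⁺₁ to Unique-applyUpTo⁺)
  open import Data.Product using (_×_; _,_; proj₁; proj₂; ∃-syntax)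
  open import Data.Sum using (inj₁; inj₂)
  open import Relation.Nullary
  open import Relation.Binary.PropositionalEquality
  open import Function using (_∘_; id)

  open ≤-Reasoning

  private variable
    A B C : Set
    c q : ℕ

  length-cartesianProductWith : ∀ (f : A → B → C) xs ys →
                                length (cartesianProductWith f xs ys) ≡ length xs * length ys
  length-cartesianProductWith f []       ys = refl
  length-cartesianProductWith f (x ∷ xs) ys = trans (length-++ (map (f x) ys))
    (cong₂ _+_ (length-map (f x) ys) (length-cartesianProductWith f xs ys))

  -- Progressions of length k modulo q with nonzero difference do not repeat a residue.
  Rigid : ℕ → ℕ → Set
  Rigid k q = ∀ a d → 0 < a → a < k → q ∣ a * d → q ∣ d

  -- Since `0 < a < k ≤ p`, the prime does not divide `a`, so its factors are all found in `d`, one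
  -- at a time.
  prime-power-rigid : ∀ {k p} → Prime p → k ≤ p → ∀ t → Rigid k (p ^ t)
  prime-power-rigid {k} {p} pp k≤p zero    a d _ _ _ = 1∣ d
  prime-power-rigid {k} {p} pp k≤p (suc t) a d 0<a a<k pᵗ⁺¹∣ad
    with euclidsLemma a d pp (∣-trans (m∣m*n (p ^ t)) pᵗ⁺¹∣ad)
  ... | inj₁ p∣a = contradiction (∣⇒≤ {{>-nonZero 0<a}} p∣a) (<⇒≱ (<-≤-trans a<k k≤p))
  ... | inj₂ (divides-refl d′) = subst (p * p ^ t ∣_) (*-comm p d′) (*-monoʳ-∣ p
          (prime-power-rigid pp k≤p t a d′ 0<a a<k
            (*-cancelˡ-∣ p {{prime⇒nonZero pp}} (subst (p * p ^ t ∣_) (rearrange a d′ p) pᵗ⁺¹∣ad))))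
    where
    rearrange : ∀ a d p → a * (d * p) ≡ p * (a * d)
    rearrange = solve-∀

  %-≡⇒∣∸ : ∀ m n q .{{_ : NonZero q}} → m % q ≡ n % q → q ∣ n ∸ m
  %-≡⇒∣∸ m n q m≡n = divides (n / q ∸ m / q) (begin-equality
    n ∸ m                                          ≡⟨ cong₂ _∸_ (m≡m%n+[m/n]*n n q) (trans (m≡m%n+[m/n]*n m q) (cong (_+ m / q * q) m≡n)) ⟩
    (n % q + n / q * q) ∸ (n % q + m / q * q)      ≡⟨ [m+n]∸[m+o]≡n∸o (n % q) _ _ ⟩
    n / q * q ∸ m / q * q                          ≡⟨ *-distribʳ-∸ q (n / q) (m / q) ⟨
    (n / q ∸ m / q) * q                            ∎)

  mod-cong : ∀ m n q .{{_ : NonZero q}} → m % q ≡ n % q → m mod q ≡ n mod q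
  mod-cong m n q m≡n = Fin.fromℕ<-cong _ _ m≡n _ _

  toℕ-mod : ∀ m q .{{_ : NonZero q}} → toℕ (m mod q) ≡ m % q
  toℕ-mod m q = Fin.toℕ-fromℕ< _

  mod-injective : ∀ m n q .{{_ : NonZero q}} → m mod q ≡ n mod q → m % q ≡ n % q
  mod-injective m n q m≡n = trans (sym (toℕ-mod m q)) (trans (cong toℕ m≡n) (toℕ-mod n q))

  %-+-congˡ : ∀ m n o q .{{_ : NonZero q}} → m % q ≡ n % q → (m + o) % q ≡ (n + o) % q
  %-+-congˡ m n o q m≡n = trans (%-distribˡ-+ m o q)
    (trans (cong (λ z → (z + o % q) % q) m≡n) (sym (%-distribˡ-+ n o q)))

  rigid⇒distinct : ∀ {k q} .{{_ : NonZero q}} → Rigid k q → ∀ s d → q ∤ d →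
                   ∀ {i j} → i < j → j < k → (s + i * d) mod q ≢ (s + j * d) mod q
  rigid⇒distinct {q = q} rigid s d q∤d {i} {j} i<j j<k same = q∤d
    (rigid (j ∸ i) d (m<n⇒0<n∸m i<j) (≤-<-trans (m∸n≤m j i) j<k)
      (subst (q ∣_) (trans ([m+n]∸[m+o]≡n∸o s (j * d) (i * d)) (sym (*-distribʳ-∸ d j i)))
        (%-≡⇒∣∸ (s + i * d) (s + j * d) q (mod-injective _ _ q same))))

  digit : ∀ p .{{_ : NonZero p}} → ℕ → ℕ → Fin p
  digit p t x = ((x / p ^ t) {{m^n≢0 p t}}) mod p

  module _ {q} .{{_ : NonZero q}} where

    progression : ℕ → ℕ → ℕ → List (Fin q)
    progression k s d = applyUpTo (λ i → (s + i * d) mod q) k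

    applyUpTo-cong : ∀ {f g : ℕ → A} → (∀ i → f i ≡ g i) → ∀ n → applyUpTo f n ≡ applyUpTo g n
    applyUpTo-cong f≡g zero    = refl
    applyUpTo-cong f≡g (suc n) = cong₂ _∷_ (f≡g 0) (applyUpTo-cong (λ i → f≡g (suc i)) n)

    progression-cong : ∀ k s s′ d → s % q ≡ s′ % q → progression k s d ≡ progression k s′ d
    progression-cong k s s′ d s≡s′ =
      applyUpTo-cong {f = λ i → (s + i * d) mod q} {λ i → (s′ + i * d) mod q} (λ i → mod-cong _ _ q (%-+-congˡ s s′ (i * d) q s≡s′)) k

    +*-%-cong : ∀ s s′ i d d′ → s % q ≡ s′ % q → d % q ≡ d′ % q → (s + i * d) % q ≡ (s′ + i * d′) % q
    +*-%-cong s s′ i d d′ s≡s′ d≡d′ = begin-equality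
      (s + i * d) % q     ≡⟨ %-+-congˡ s s′ (i * d) q s≡s′ ⟩
      (s′ + i * d) % q    ≡⟨ cong (_% q) (+-comm s′ (i * d)) ⟩
      (i * d + s′) % q    ≡⟨ %-+-congˡ (i * d) (i * d′) s′ q (trans (%-distribˡ-* i d q)
                               (trans (cong (λ z → ((i % q) * z) % q) d≡d′) (sym (%-distribˡ-* i d′ q)))) ⟩
      (i * d′ + s′) % q   ≡⟨ cong (_% q) (+-comm (i * d′) s′) ⟩
      (s′ + i * d′) % q   ∎

    -- The local lemma with `1 + u = 2k`: a point lies in at most `k * (q - 1)` progressions, by its
    -- position and the difference, and `2 * (1 + u)` accounts for the factor `4 * k`.
    cyclic-colouring : ∀ κ c .{{_ : NonZero c}} → Rigid (suc κ) q → 4 * suc κ * (suc κ * q) ≤ c ^ κ →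
      ∃[ f ] (∀ s d → q ∤ d → ¬ (∀ i j → i < suc κ → j < suc κ →
                lookup {A = Fin c} f ((s + i * d) mod q) ≡ lookup f ((s + j * d) mod q)))
    cyclic-colouring κ c rigid q-small = f , λ s d q∤d mono → f-good (edge∈E s d q∤d) (mono⇒Mono s d q∤d mono)
      where
      k : ℕ
      k = suc κ
      E : List (List (Fin q))
      E = cartesianProductWith (λ s d → progression k s (suc d)) (upTo q) (upTo (pred q))
      -- The progression with `v` as its term number `j`. Its start `v - j * suc d` is taken modulo
      -- `q` by means of the complement `q ∸ suc d`.
      through : Fin q → ℕ → ℕ → List (Fin q)
      through v j d = progression k (toℕ v + j * (q ∸ suc d)) (suc d)
      D : Fin q → List (List (Fin q))
      D v = cartesianProductWith (through v) (upTo k) (upTo (pred q))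
      1+d<q : ∀ {d} → d ∈ upTo (pred q) → suc d < q
      1+d<q d∈ = subst (_ <_) (suc-pred q) (s<s (∈-upTo⁻ d∈))
      q∤ : ∀ {d} → suc d < q → q ∤ suc d
      q∤ 1+d<q q∣ = <⇒≱ 1+d<q (∣⇒≤ q∣)
      inhabited : ∀ {e} → e ∈ E → ∃[ v ] v ∈ e
      inhabited e∈E with ∈-cartesianProductWith⁻ _ (upTo q) (upTo (pred q)) e∈E
      ... | s , d , _ , _ , refl = _ , ∈-applyUpTo⁺ (λ i → (s + i * suc d) mod q) z<s
      through-≡ : ∀ s d j → suc d < q → through ((s + j * suc d) mod q) j d ≡ progression k s (suc d)
      through-≡ s d j 1+d<q = progression-cong k _ s (suc d) (begin-equality
        (toℕ ((s + j * suc d) mod q) + j * (q ∸ suc d)) % q    ≡⟨ cong (λ z → (z + j * (q ∸ suc d)) % q) (toℕ-mod (s + j * suc d) q) ⟩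
        ((s + j * suc d) % q + j * (q ∸ suc d)) % q            ≡⟨ %-+-congˡ ((s + j * suc d) % q) (s + j * suc d) _ q (m%n%n≡m%n (s + j * suc d) q) ⟩
        (s + j * suc d + j * (q ∸ suc d)) % q                  ≡⟨ cong (_% q) (rearrange s j (suc d) (q ∸ suc d)) ⟩
        (s + j * (suc d + (q ∸ suc d))) % q                    ≡⟨ cong (λ z → (s + j * z) % q) (m+[n∸m]≡n (<⇒≤ 1+d<q)) ⟩
        (s + j * q) % q                                        ≡⟨ [m+kn]%n≡m%n s j q ⟩
        s % q                                                  ∎)
        where
        rearrange : ∀ s j x y → s + j * x + j * y ≡ s + j * (x + y)
        rearrange = solve-∀
      cover : ∀ {e v} → e ∈ E → v ∈ e → ∃[ e′ ] e′ ∈ D v × All (_∈ e) e′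
      cover e∈E v∈e with ∈-cartesianProductWith⁻ _ (upTo q) (upTo (pred q)) e∈E
      ... | s , d , _ , d∈ , refl with ∈-applyUpTo⁻ (λ i → (s + i * suc d) mod q) v∈e
      ...   | j , j<k , refl =
        _ , ∈-cartesianProductWith⁺ (through ((s + j * suc d) mod q)) (∈-upTo⁺ j<k) d∈ ,
        subst (All (_∈ progression k s (suc d))) (sym (through-≡ s d j (1+d<q d∈))) (All.tabulate id)
      uniform : ∀ {v e} → e ∈ D v → Unique e × length e ≡ k
      uniform {v} e∈D with ∈-cartesianProductWith⁻ (through v) (upTo k) (upTo (pred q)) e∈D
      ... | j , d , _ , d∈ , refl =
        Unique-applyUpTo⁺ _ k (rigid⇒distinct rigid (toℕ v + j * (q ∸ suc d)) (suc d) (q∤ (1+d<q d∈))) ,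
        length-applyUpTo (λ i → (toℕ v + j * (q ∸ suc d) + i * suc d) mod q) k
      degree : ∀ v → 2 * suc (κ + suc κ) * length (D v) ≤ c ^ κ
      degree v = begin
        2 * suc (κ + suc κ) * length (D v)    ≡⟨ cong (2 * suc (κ + suc κ) *_) (trans (length-cartesianProductWith (through v) (upTo k) (upTo (pred q)))
                                                   (cong₂ _*_ (length-upTo k) (length-upTo (pred q)))) ⟩
        2 * suc (κ + suc κ) * (k * pred q)    ≤⟨ *-monoʳ-≤ (2 * suc (κ + suc κ)) (*-monoʳ-≤ k pred[n]≤n) ⟩
        2 * suc (κ + suc κ) * (k * q)         ≡⟨ cong (_* (k * q)) (rearrange κ) ⟩
        4 * k * (k * q)                       ≤⟨ q-small ⟩
        c ^ κ                                 ∎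
        where
        rearrange : ∀ κ → 2 * suc (κ + suc κ) ≡ 4 * suc κ
        rearrange = solve-∀
      module L = LocalLemma c q κ (κ + suc κ) refl E inhabited D cover uniform degree
      f : Vec (Fin c) q
      f = proj₁ L.∃valid
      f-good : ∀ {e} → e ∈ E → ¬ Mono f e
      f-good = proj₂ L.∃valid
      -- Reduction modulo `q` brings an arbitrary progression into `E`, whose differences have the
      -- form `suc d` and so leave out zero.
      reduced : ℕ → ℕ → List (Fin q)
      reduced s d = progression k (s % q) (suc (pred (d % q)))
      d%q≢0 : ∀ d → q ∤ d → NonZero (d % q)
      d%q≢0 d q∤d = ≢-nonZero (q∤d ∘ m%n≡0⇒n∣m d q)
      edge∈E : ∀ s d → q ∤ d → reduced s d ∈ E
      edge∈E s d q∤d = ∈-cartesianProductWith⁺ (λ s d → progression k s (suc d)) (∈-upTo⁺ (m%n<n s q))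
        (∈-upTo⁺ (pred-mono-< {{d%q≢0 d q∤d}} (m%n<n d q)))
      reduced-≡ : ∀ s d i → q ∤ d → (s % q + i * suc (pred (d % q))) mod q ≡ (s + i * d) mod q
      reduced-≡ s d i q∤d = mod-cong _ _ q (+*-%-cong (s % q) s i _ d (m%n%n≡m%n s q)
        (trans (cong (_% q) (suc-pred (d % q) {{d%q≢0 d q∤d}})) (m%n%n≡m%n d q)))
      mono⇒Mono : ∀ s d → q ∤ d → (∀ i j → i < k → j < k → lookup f ((s + i * d) mod q) ≡ lookup f ((s + j * d) mod q)) →
                  Mono f (reduced s d)
      mono⇒Mono s d q∤d mono = All-applyUpTo⁺ _ k λ {i} i<k → All-applyUpTo⁺ _ k λ {j} j<k →
        subst₂ (λ x y → lookup f x ≡ lookup f y) (sym (reduced-≡ s d i q∤d)) (sym (reduced-≡ s d j q∤d)) (mono i j i<k j<k)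

    -- A first-moment argument over the `N * N` pairs of `s` and `d`. By rigidity `φ` takes
    -- independent values at the terms, and each has to be among `m` digits fixed in advance by the
    -- quotient. The expected total weight is below 1, so some `φ` has weight 0.
    ∃selector : ∀ k p .{{_ : NonZero p}} m N → Rigid k q → N * N * m ^ k < p ^ k →
      ∃[ φ ] (∀ s d → s < N → d < N → q ∤ d →
        ¬ (∀ i → i < k → ∃[ t ] t < m × lookup φ ((s + i * d) mod q) ≡ digit p t ((s + i * d) / q)))
    ∃selector k p m N rigid few = φ , λ s d s<N d<N q∤d shown →
      <⇒≱ φ-good (≤-trans (∏-positive {f = φ} (All-applyUpTo⁺ _ k λ {i} i<k → shown⇒positive s d i {φ} (shown i i<k)))
                  (≤-trans (≤-reflexive (sym (weight-≡ s d φ q∤d)))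
                    (≤-trans (∈⇒≤∑ (λ d → weight s d φ) (∈-upTo⁺ d<N)) (∈⇒≤∑ (λ s → ∑ (upTo N) λ d → weight s d φ) (∈-upTo⁺ s<N)))))
      where
      -- Digit positions are counted with multiplicity: the count is positive whenever a digit is
      -- hit, and its sum over the possible values of `φ` there is at most `m` even if digits
      -- repeat.
      shows : ℕ → ℕ → ℕ → Vec (Fin p) q → ℕ
      shows s d i f = ∑ (upTo m) λ t → 𝟙 (lookup f ((s + i * d) mod q) Fin.≟ digit p t ((s + i * d) / q))
      tests : ℕ → ℕ → List (Test p q)
      tests s d = applyUpTo (λ i → (s + i * d) mod q , shows s d i) k
      weight : ℕ → ℕ → Vec (Fin p) q → ℕ
      weight s d f with q ∣? d
      ... | yes _ = 0
      ... | no  _ = ∏ (tests s d) f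
      weight-≡ : ∀ s d f → q ∤ d → weight s d f ≡ ∏ (tests s d) f
      weight-≡ s d f q∤d with q ∣? d
      ... | yes q∣d = contradiction q∣d q∤d
      ... | no  _   = refl
      shown⇒positive : ∀ s d i {f} → ∃[ t ] t < m × lookup f ((s + i * d) mod q) ≡ digit p t ((s + i * d) / q) →
                       1 ≤ shows s d i f
      shown⇒positive s d i {f} (t , t<m , eq) = ≤-trans (𝟙-true (_ Fin.≟ _) eq)
        (∈⇒≤∑ (λ t → 𝟙 (lookup f ((s + i * d) mod q) Fin.≟ digit p t ((s + i * d) / q))) (∈-upTo⁺ t<m))
      ignores : ∀ s d → q ∤ d → ∀ {i j} → i < j → j < k → Ignores ((s + i * d) mod q) (shows s d j)
      ignores s d q∤d {i} {j} i<j j<k f x = ∑-cong (upTo m) λ t →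
        cong (λ y → 𝟙 (y Fin.≟ digit p t ((s + j * d) / q)))
             (lookup∘update′ (rigid⇒distinct rigid s d q∤d i<j j<k ∘ sym) f x)
      at-most-m : ∀ s d i f → ∑ (allFin p) (λ x → shows s d i (f [ (s + i * d) mod q ]≔ x)) ≤ m
      at-most-m s d i f = begin
        ∑ (allFin p) (λ x → shows s d i (f [ y ]≔ x))
          ≡⟨ ∑-cong (allFin p) (λ x → ∑-cong (upTo m) λ t → cong (λ z → 𝟙 (z Fin.≟ w t)) (lookup∘update y f x)) ⟩
        ∑ (allFin p) (λ x → ∑ (upTo m) λ t → 𝟙 (x Fin.≟ w t))
          ≡⟨ ∑-swap (allFin p) (upTo m) _ ⟩
        ∑ (upTo m) (λ t → ∑ (allFin p) λ x → 𝟙 (x Fin.≟ w t))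
          ≤⟨ ∑-mono (upTo m) (λ t _ → ∑-𝟙-≟ p (w t)) ⟩
        ∑ (upTo m) (λ _ → 1)
          ≡⟨ trans (∑-const (upTo m) 1) (trans (*-identityʳ _) (length-upTo m)) ⟩
        m ∎
        where
        y : Fin q
        y = (s + i * d) mod q
        w : ℕ → Fin p
        w t = digit p t ((s + i * d) / q)
      rare : ∀ s d → p ^ k * ∑ᵛ (weight s d) ≤ m ^ k * p ^ q
      rare s d with q ∣? d
      ... | yes _  = ≤-trans (≤-reflexive (trans (cong (p ^ k *_) (trans (∑ᵛ-const p q 0) (*-zeroʳ (p ^ q)))) (*-zeroʳ (p ^ k)))) z≤n
      ... | no q∤d = begin
        p ^ k * ∑ᵛ (∏ (tests s d))                            ≡⟨ cong₂ (λ l z → p ^ l * z) (sym length-tests) (∑ᵛ-cong (λ f → sym (*-identityˡ (∏ (tests s d) f)))) ⟩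
        p ^ length (tests s d) * ∑ᵛ (λ f → 1 * ∏ (tests s d) f) ≤⟨ independent-tests m (λ _ → 1) (tests s d)
                                                                     (All-applyUpTo⁺₂ _ k (λ i f x → refl))
                                                                     (AllPairs-applyUpTo⁺ _ k (ignores s d q∤d))
                                                                     (All-applyUpTo⁺₂ _ k (at-most-m s d)) ⟩
        m ^ length (tests s d) * ∑ᵛ {p} {q} (λ _ → 1)         ≡⟨ cong₂ (λ l z → m ^ l * z) length-tests (trans (∑ᵛ-const p q 1) (*-identityʳ (p ^ q))) ⟩
        m ^ k * p ^ q                                         ∎
        where
        length-tests : length (tests s d) ≡ k
        length-tests = length-applyUpTo _ k
      total : Vec (Fin p) q → ℕ
      total f = ∑ (upTo N) λ s → ∑ (upTo N) λ d → weight s d f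
      total-small : ∑ᵛ total < ∑ᵛ {p} {q} (λ _ → 1)
      total-small = *-cancelˡ-< (p ^ k) _ _ (begin-strict
        p ^ k * ∑ᵛ total
          ≡⟨ cong (p ^ k *_) (trans (∑ᵛ-∑ (upTo N) (λ s f → ∑ (upTo N) λ d → weight s d f))
                                    (∑-cong (upTo N) (λ s → ∑ᵛ-∑ (upTo N) (weight s)))) ⟩
        p ^ k * ∑ (upTo N) (λ s → ∑ (upTo N) λ d → ∑ᵛ (weight s d))
          ≡⟨ trans (sym (∑-*ˡ (upTo N) (p ^ k) _)) (∑-cong (upTo N) (λ s → sym (∑-*ˡ (upTo N) (p ^ k) (λ d → ∑ᵛ (weight s d))))) ⟩
        ∑ (upTo N) (λ s → ∑ (upTo N) λ d → p ^ k * ∑ᵛ (weight s d))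
          ≤⟨ ∑-mono (upTo N) (λ s _ → ∑-mono (upTo N) λ d _ → rare s d) ⟩
        ∑ (upTo N) (λ s → ∑ (upTo N) λ d → m ^ k * p ^ q)
          ≡⟨ trans (∑-cong (upTo N) (λ _ → ∑-const (upTo N) _)) (∑-const (upTo N) _) ⟩
        length (upTo N) * (length (upTo N) * (m ^ k * p ^ q))
          ≡⟨ cong (λ l → l * (l * (m ^ k * p ^ q))) (length-upTo N) ⟩
        N * (N * (m ^ k * p ^ q))
          ≡⟨ rearrange N (m ^ k) (p ^ q) ⟩
        N * N * m ^ k * p ^ q
          <⟨ *-monoˡ-< (p ^ q) {{m^n≢0 p q}} few ⟩
        p ^ k * p ^ q
          ≡⟨ cong (p ^ k *_) (trans (∑ᵛ-const p q 1) (*-identityʳ (p ^ q))) ⟨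
        p ^ k * ∑ᵛ {p} {q} (λ _ → 1) ∎)
        where
        rearrange : ∀ n x y → n * (n * (x * y)) ≡ n * n * x * y
        rearrange = solve-∀
      light : ∃[ f ] total f < 1
      light = ∑ᵛ-<⇒∃ {g = total} {h = λ _ → 1} total-small
      φ : Vec (Fin p) q
      φ = proj₁ light
      φ-good : total φ < 1
      φ-good = proj₂ light

-- Base `p` digits along progressions and the product of two colourings.

module Products where

  open Primes
  open Cyclic
  open import Data.Nat
  open import Data.Nat.Properties
  open import Data.Nat.Divisibility
  open import Data.Nat.DivMod
  open import Data.Nat.Primality
  open import Data.Nat.Induction using (<-rec)
  open import Data.Nat.Coprimality using (coprime-Bézout)
  open import Data.Nat.GCD using (module Bézout)
  open import Data.Nat.Tactic.RingSolver using (solve-∀)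
  open import Data.Fin using (Fin; zero; suc; toℕ)
  import Data.Fin.Properties as Fin
  open import Data.Vec using (Vec; lookup)
  open import Data.Product using (_×_; _,_; ∃-syntax)
  open import Data.Sum using (_⊎_; inj₁; inj₂)
  open import Data.Sum.Properties using (inj₁-injective; inj₂-injective)
  open import Data.Empty using (⊥)
  open import Relation.Nullary
  open import Relation.Binary.PropositionalEquality

  open ≤-Reasoning

  prime-part : ∀ {p} → Prime p → ∀ d → 0 < d → ∃[ t ] ∃[ d′ ] d ≡ d′ * p ^ t × p ∤ d′
  prime-part {p} pp = <-rec _ λ d rec 0<d → split d rec 0<d (p ∣? d)
    where
    split : ∀ d → (∀ {e} → e < d → 0 < e → ∃[ t ] ∃[ d′ ] e ≡ d′ * p ^ t × p ∤ d′) → 0 < d → Dec (p ∣ d) →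
            ∃[ t ] ∃[ d′ ] d ≡ d′ * p ^ t × p ∤ d′
    split d rec 0<d (no p∤d) = 0 , d , sym (*-identityʳ d) , p∤d
    split _ rec 0<d (yes (divides-refl zero)) = contradiction 0<d (<-irrefl refl)
    split _ rec 0<d (yes (divides-refl e@(suc _))) with rec (m<m*n e p {{_}} (nonTrivial⇒n>1 p {{prime⇒nonTrivial pp}})) z<s
    ... | t , d′ , e≡ , p∤d′ = suc t , d′ , trans (cong (_* p) e≡) (rearrange d′ (p ^ t) p) , p∤d′
      where
      rearrange : ∀ d x p → d * x * p ≡ d * (p * x)
      rearrange = solve-∀

  inverse : ∀ {p d} → Prime p → p ∤ d → ∃[ y ] ∃[ u ] ∃[ v ] y * d + u * p ≡ 1 + v * p
  inverse {p} {d} pp p∤d with coprime-Bézout (prime∤⇒coprime pp p∤d)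
  ... | Bézout.-+ x y eq = y , 0 , x , trans (+-identityʳ (y * d)) (sym eq)
  ... | Bézout.+- x y eq with p | prime⇒nonZero pp
  -- Here `1 + y * d` is a multiple of `p`, so the inverse is `- y`, represented by `y * (p - 1)`.
  ...   | suc P | _ = y * P , 1 , x * P , (begin-equality
          y * P * d + 1 * suc P              ≡⟨ left y P d ⟩
          1 + P * (1 + y * d)                ≡⟨ cong (λ z → 1 + P * z) eq ⟩
          1 + P * (x * suc P)                ≡⟨ right x P ⟩
          1 + x * P * suc P                  ∎)
    where
    left : ∀ y P d → y * P * d + 1 * suc P ≡ 1 + P * (1 + y * d)
    left = solve-∀
    right : ∀ x P → 1 + P * (x * suc P) ≡ 1 + x * P * suc P
    right = solve-∀

  all-residues : ∀ {p d} .{{_ : NonZero p}} → Prime p → p ∤ d → ∀ a (w : Fin p) → ∃[ i ] i < p × (a + i * d) mod p ≡ w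
  all-residues {p} {d} pp p∤d a w with inverse pp p∤d
  ... | y , u , v , yd+up≡1+vp = i₀ % p , m%n<n i₀ p , Fin.toℕ-injective (begin-equality
    toℕ ((a + i₀ % p * d) mod p)              ≡⟨ toℕ-mod (a + i₀ % p * d) p ⟩
    (a + i₀ % p * d) % p                      ≡⟨ cong (λ z → (a + z) % p) (*-comm (i₀ % p) d) ⟩
    (a + d * (i₀ % p)) % p                    ≡⟨ +*-%-cong a a d (i₀ % p) i₀ refl (m%n%n≡m%n i₀ p) ⟩
    (a + d * i₀) % p                          ≡⟨ [m+kn]%n≡m%n (a + d * i₀) (b * u) p ⟨
    (a + d * i₀ + b * u * p) % p              ≡⟨ cong (_% p) (factor a b y d u p) ⟩
    (a + b * (y * d + u * p)) % p             ≡⟨ cong (λ z → (a + b * z) % p) yd+up≡1+vp ⟩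
    (a + b * (1 + v * p)) % p                 ≡⟨ cong (_% p) (expand a b v p) ⟩
    (a + b + b * v * p) % p                   ≡⟨ [m+kn]%n≡m%n (a + b) (b * v) p ⟩
    (a + b) % p                               ≡⟨ cong (λ z → (z + b) % p) (m≡m%n+[m/n]*n a p) ⟩
    (a % p + a / p * p + b) % p               ≡⟨ cong (_% p) (gather (a % p) (a / p * p) (toℕ w) (p ∸ a % p)) ⟩
    (toℕ w + (a % p + (p ∸ a % p)) + a / p * p) % p
                                              ≡⟨ [m+kn]%n≡m%n (toℕ w + (a % p + (p ∸ a % p))) (a / p) p ⟩
    (toℕ w + (a % p + (p ∸ a % p))) % p       ≡⟨ cong (λ z → (toℕ w + z) % p) (m+[n∸m]≡n (m%n≤n a p)) ⟩
    (toℕ w + p) % p                           ≡⟨ [m+n]%n≡m%n (toℕ w) p ⟩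
    toℕ w % p                                 ≡⟨ m<n⇒m%n≡m (Fin.toℕ<n w) ⟩
    toℕ w                                     ∎)
    where
    b i₀ : ℕ
    -- `b` represents `w - a` modulo `p`, and `i₀` is its product with the inverse of `d`.
    b = toℕ w + (p ∸ a % p)
    i₀ = y * b
    factor : ∀ a b y d u p → a + d * (y * b) + b * u * p ≡ a + b * (y * d + u * p)
    factor = solve-∀
    expand : ∀ a b v p → a + b * (1 + v * p) ≡ a + b + b * v * p
    expand = solve-∀
    gather : ∀ r x w s → r + x + (w + s) ≡ w + (r + s) + x
    gather = solve-∀

  /-power : ∀ {p} .{{_ : NonZero p}} t x a → .{{_ : NonZero (p ^ t)}} → (x + a * p ^ t) / p ^ t ≡ x / p ^ t + a
  /-power {p} t x a = begin-equality
    (x + a * p ^ t) / p ^ t              ≡⟨ +-distrib-/-∣ʳ x (n∣m*n a) ⟩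
    x / p ^ t + a * p ^ t / p ^ t        ≡⟨ cong (x / p ^ t +_) (m*n/n≡m a (p ^ t)) ⟩
    x / p ^ t + a                        ∎

  digit-shift : ∀ {p} .{{_ : NonZero p}} t x i d → digit p t (x + i * (d * p ^ t)) ≡ ((x / p ^ t) {{m^n≢0 p t}} + i * d) mod p
  digit-shift {p} t x i d = cong (_mod p) (trans (/-congˡ {o = p ^ t} (cong (x +_) (sym (*-assoc i d (p ^ t))))) (/-power t x (i * d)))
    where instance _ = m^n≢0 p t

  -- If p ^ t is the exact power of p dividing d, the t-th base p digit runs through all values.
  digit-hit : ∀ {p} .{{_ : NonZero p}} → Prime p → ∀ m d → 0 < d → d < p ^ m → ∀ x (w : Fin p) →
              ∃[ i ] i < p × ∃[ t ] t < m × w ≡ digit p t (x + i * d)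
  digit-hit {p} pp m d 0<d d<p^m x w =
    let t , d′ , d≡ , p∤d′ = prime-part pp d 0<d
        i , i<p , hit = all-residues pp p∤d′ ((x / p ^ t) {{m^n≢0 p t}}) w
        d′≢0 = ≢-nonZero λ d′≡0 → p∤d′ (subst (p ∣_) (sym d′≡0) (p ∣0))
        t<m = ≰⇒> λ m≤t → <⇒≱ d<p^m (≤-trans (^-monoʳ-≤ p m≤t) (subst (p ^ t ≤_) (sym d≡) (m≤n*m (p ^ t) d′ {{d′≢0}})))
    in i , i<p , t , t<m ,
       trans (sym hit) (trans (sym (digit-shift t x i d′)) (cong (λ z → digit p t (x + i * z)) (sym d≡)))

  Constant : ∀ {A : Set} → ℕ → (ℕ → A) → Set
  Constant k g = ∀ i j → i < k → j < k → g i ≡ g j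

  -- Colourings are total on the naturals, with only the progressions below `N` constrained;
  -- products and restrictions then involve no change of domain.
  APFree : ∀ {A : Set} → ℕ → ℕ → (ℕ → A) → Set
  APFree k N f = ∀ s d → 0 < d → (∀ i → i < k → s + i * d < N) → ¬ Constant k (λ i → f (s + i * d))

  module Product {A : Set} {k c q p m M : ℕ} .{{_ : NonZero q}} .{{_ : NonZero p}}
    (2≤k : 2 ≤ k) (pp : Prime p) (p≤k : p ≤ k) (M≤p^m : M ≤ p ^ m)
    (f : ℕ → A) (f-free : APFree k M f)
    (g : Vec (Fin c) q) (g-free : ∀ s d → q ∤ d → ¬ Constant k (λ i → lookup g ((s + i * d) mod q)))
    (φ : Vec (Fin p) q)
    (φ-good : ∀ s d → s < M * q → d < M * q → q ∤ d →
       ¬ (∀ i → i < k → ∃[ t ] t < m × lookup φ ((s + i * d) mod q) ≡ digit p t ((s + i * d) / q)))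
    where

    Shown : ℕ → Set
    Shown n = ∃[ t ] t < m × lookup φ (n mod q) ≡ digit p t (n / q)

    shown? : ∀ n → Dec (Shown n)
    shown? n = anyUpTo? (λ t → lookup φ (n mod q) Fin.≟ digit p t (n / q)) m

    choose : {P : Set} → Dec P → A → Fin c → A ⊎ Fin c
    choose (yes _) x y = inj₁ x
    choose (no _)  x y = inj₂ y

    choose-yes : ∀ {P} (P? : Dec P) x y → P → choose P? x y ≡ inj₁ x
    choose-yes (yes _) x y p = refl
    choose-yes (no ¬p) x y p = contradiction p ¬p

    choose-no : ∀ {P} (P? : Dec P) x y → ¬ P → choose P? x y ≡ inj₂ y
    choose-no (yes p) x y ¬p = contradiction p ¬p
    choose-no (no _)  x y ¬p = refl

    choose-transfer : ∀ {P Q} (P? : Dec P) (Q? : Dec Q) x y x′ y′ → choose P? x y ≡ choose Q? x′ y′ → P → Q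
    choose-transfer (yes _) (yes q) x y x′ y′ eq p = q
    choose-transfer (no ¬p) _       x y x′ y′ eq p = contradiction p ¬p

    colour : ℕ → A ⊎ Fin c
    colour n = choose (shown? n) (f (n / q)) (lookup g (n mod q))

    -- The two palettes are disjoint, so a colour reveals whether its point is shown; a
    -- monochromatic progression is shown at all its terms or at none.
    transfer : ∀ n n′ → colour n ≡ colour n′ → Shown n → Shown n′
    transfer n n′ = choose-transfer (shown? n) (shown? n′) _ _ _ _

    0<k : 0 < k
    0<k = <-trans z<s 2≤k

    d≤s+1*d : ∀ s d → d ≤ s + 1 * d
    d≤s+1*d s d = ≤-trans (≤-reflexive (sym (*-identityˡ d))) (m≤n+m (1 * d) s)

    module _ (s d : ℕ) (same : Constant k (λ i → colour (s + i * d))) where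

      all-shown : Shown (s + 0 * d) → ∀ i → i < k → Shown (s + i * d)
      all-shown shown₀ i i<k = transfer (s + 0 * d) (s + i * d) (same 0 i 0<k i<k) shown₀

      none-shown : ¬ Shown (s + 0 * d) → ∀ i → i < k → ¬ Shown (s + i * d)
      none-shown hidden₀ i i<k shown = hidden₀ (transfer (s + i * d) (s + 0 * d) (same i 0 i<k 0<k) shown)

      f-constant : Shown (s + 0 * d) → Constant k (λ i → f ((s + i * d) / q))
      f-constant shown₀ i j i<k j<k = inj₁-injective
        (trans (sym (choose-yes (shown? (s + i * d)) _ _ (all-shown shown₀ i i<k)))
          (trans (same i j i<k j<k) (choose-yes (shown? (s + j * d)) _ _ (all-shown shown₀ j j<k))))

      g-constant : ¬ Shown (s + 0 * d) → Constant k (λ i → lookup g ((s + i * d) mod q))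
      g-constant hidden₀ i j i<k j<k = inj₂-injective
        (trans (sym (choose-no (shown? (s + i * d)) _ _ (none-shown hidden₀ i i<k)))
          (trans (same i j i<k j<k) (choose-no (shown? (s + j * d)) _ _ (none-shown hidden₀ j j<k))))

    /-fibre : ∀ s i e → (s + i * (e * q)) / q ≡ s / q + i * e
    /-fibre s i e = begin-equality
      (s + i * (e * q)) / q        ≡⟨ /-congˡ (cong (s +_) (sym (*-assoc i e q))) ⟩
      (s + i * e * q) / q          ≡⟨ +-distrib-/-∣ʳ s (n∣m*n (i * e)) ⟩
      s / q + i * e * q / q        ≡⟨ cong (s / q +_) (m*n/n≡m (i * e) q) ⟩
      s / q + i * e                ∎

    mod-fibre : ∀ s i e → (s + i * (e * q)) mod q ≡ s mod q
    mod-fibre s i e = mod-cong _ _ q (trans (cong (λ z → (s + z) % q) (sym (*-assoc i e q))) ([m+kn]%n≡m%n s (i * e) q))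

    fibre-free : ∀ s e → 0 < e → (∀ i → i < k → s + i * (e * q) < M * q) → ¬ Constant k (λ i → colour (s + i * (e * q)))
    fibre-free s e 0<e in-range same = decide (shown? (s + 0 * (e * q)))
      where
      in-range′ : ∀ i → i < k → s / q + i * e < M
      in-range′ i i<k = subst (_< M) (/-fibre s i e) (m<n*o⇒m/o<n (in-range i i<k))
      -- The second quotient `s / q + 1 * e` is below `M`. This places the exact power of `p` in `e`
      -- among the `m` digit positions.
      e<p^m : e < p ^ m
      e<p^m = <-≤-trans (≤-<-trans (d≤s+1*d (s / q) e) (in-range′ 1 2≤k)) M≤p^m
      decide : Dec (Shown (s + 0 * (e * q))) → ⊥
      decide (yes shown₀) = f-free (s / q) e 0<e in-range′ λ i j i<k j<k →
        subst₂ (λ x y → f x ≡ f y) (/-fibre s i e) (/-fibre s j e) (f-constant s (e * q) same shown₀ i j i<k j<k)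
      decide (no hidden₀) =
        let i , i<p , t , t<m , hit = digit-hit pp m e 0<e e<p^m (s / q) (lookup φ (s mod q))
        in none-shown s (e * q) same hidden₀ i (<-≤-trans i<p p≤k)
             (t , t<m , trans (cong (lookup φ) (mod-fibre s i e)) (trans hit (cong (digit p t) (sym (/-fibre s i e)))))

    transversal-free : ∀ s d → q ∤ d → (∀ i → i < k → s + i * d < M * q) → ¬ Constant k (λ i → colour (s + i * d))
    transversal-free s d q∤d in-range same = decide (shown? (s + 0 * d))
      where
      decide : Dec (Shown (s + 0 * d)) → ⊥
      decide (yes shown₀) = φ-good s d (≤-<-trans (m≤m+n s (0 * d)) (in-range 0 0<k))
        (≤-<-trans (d≤s+1*d s d) (in-range 1 2≤k)) q∤d (all-shown s d same shown₀)
      decide (no hidden₀) = g-free s d q∤d (g-constant s d same hidden₀)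

    colour-free : APFree k (M * q) colour
    colour-free s d 0<d in-range = decide (q ∣? d)
      where
      decide : Dec (q ∣ d) → ¬ Constant k (λ i → colour (s + i * d))
      decide (no q∤d) = transversal-free s d q∤d in-range
      decide (yes (divides-refl e)) = fibre-free s e (n≢0⇒n>0 λ { refl → <-irrefl refl 0<d }) in-range

  product-colouring : ∀ {A : Set} {k c q p m M} .{{_ : NonZero q}} → 2 ≤ k → Prime p → p ≤ k → M ≤ p ^ m →
    Rigid k q → (M * q) * (M * q) * m ^ k < p ^ k →
    (f : ℕ → A) → APFree k M f →
    (g : Vec (Fin c) q) → (∀ s d → q ∤ d → ¬ Constant k (λ i → lookup g ((s + i * d) mod q))) →
    ∃[ h ] APFree {A ⊎ Fin c} k (M * q) h
  product-colouring {k = k} {q = q} {p} {m} {M} 2≤k pp p≤k M≤p^m rigid few f f-free g g-free =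
    let φ , φ-good = ∃selector {q} k p m (M * q) rigid few
        open Product {m = m} 2≤k pp p≤k M≤p^m f f-free g g-free φ φ-good
    in colour , colour-free
    where instance _ = prime⇒nonZero pp

-- Choice of the primes, iteration, and absorption of the losses.

module Parameters where

  open Primes
  open Cyclic
  open Products
  open import Data.Nat
  open import Data.Nat.Properties
  open import Data.Nat.Divisibility
  open import Data.Nat.DivMod
  open import Data.Nat.Primality
  open import Data.Nat.Tactic.RingSolver using (solve-∀)
  open import Data.Fin using (Fin; join; splitAt)
  import Data.Fin.Properties as Fin
  open import Data.Vec using (Vec; lookup)
  open import Data.Product using (_×_; _,_; proj₁; proj₂; ∃-syntax)
  open import Data.Sum using (_⊎_)
  open import Relation.Nullary
  open import Relation.Binary.PropositionalEquality
  open import Function using (_∘_)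

  open ≤-Reasoning

  ^-distribʳ-* : ∀ k m n → (m * n) ^ k ≡ m ^ k * n ^ k
  ^-distribʳ-* zero    m n = refl
  ^-distribʳ-* (suc k) m n = trans (cong (m * n *_) (^-distribʳ-* k m n)) (interchange m n (m ^ k) (n ^ k))
    where
    interchange : ∀ m n x y → m * n * (x * y) ≡ m * x * (n * y)
    interchange = solve-∀

  n<2^n : ∀ n → n < 2 ^ n
  n<2^n zero = z<s
  n<2^n (suc n) = begin-strict
    suc n              ≤⟨ n<2^n n ⟩
    2 ^ n              <⟨ m<m+n (2 ^ n) (m^n>0 2 n) ⟩
    2 ^ n + 2 ^ n      ≡⟨ cong (2 ^ n +_) (+-identityʳ (2 ^ n)) ⟨
    2 * 2 ^ n          ∎

  largest-power : ∀ p B X → 2 ≤ p → 1 ≤ B → B ≤ X → ∃[ t ] B * p ^ t ≤ X × X < B * p ^ suc t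
  largest-power p B X 2≤p 1≤B B≤X = search X (begin-strict
    X             <⟨ n<2^n X ⟩
    2 ^ X         ≤⟨ ^-monoˡ-≤ X 2≤p ⟩
    p ^ X         ≤⟨ m≤n*m (p ^ X) B {{>-nonZero 1≤B}} ⟩
    B * p ^ X     ∎)
    where
    search : ∀ t → X < B * p ^ t → ∃[ t ] B * p ^ t ≤ X × X < B * p ^ suc t
    search zero    X< = contradiction (subst (X <_) (*-identityʳ B) X<) (≤⇒≯ B≤X)
    search (suc t) X< with B * p ^ t ≤? X
    ... | yes ≤X = t , ≤X , X<
    ... | no ≰X  = search t (≰⇒> ≰X)

  -- Generously absorbs the factor c, the factor 4 k² of the local lemma and the ratio p ≤ 64 k of
  -- consecutive powers of p.
  loss : ℕ → ℕ
  loss k = (k * 16) ^ 3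

  record Block (c k : ℕ) : Set where
    field
      size : ℕ
      {{size≢0}} : NonZero size
      rigid : Rigid k size
      colouring : Vec (Fin c) size
      free : ∀ s d → size ∤ d → ¬ Constant k (λ i → lookup colouring ((s + i * d) mod size))
      lower : c ^ k ≤ loss k * size
      upper : size ≤ 4 ^ k

  -- The local lemma admits any power `q` of `p` with `4 * k * k * q ≤ c ^ κ`. The largest one
  -- misses this bound by a factor below `p`, however sparse the primes themselves are.
  block : ∀ κ c {p} → Prime p → suc κ ≤ p → p ≤ suc κ * 64 → .{{_ : NonZero c}} → c ≤ 4 →
          4 * suc κ * suc κ ≤ c ^ κ → Block c (suc κ)
  block κ c {p} pp k≤p p≤64k c≤4 4kk≤c^κ
    with largest-power p (4 * suc κ * suc κ) (c ^ κ) (nonTrivial⇒n>1 p {{prime⇒nonTrivial pp}}) z<s 4kk≤c^κ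
  ... | t , fits , too-big = record
    { size = q
    ; rigid = q-rigid
    ; colouring = proj₁ colour
    ; free = λ s d q∤d constant → proj₂ colour s d q∤d constant
    ; lower = begin
        c * c ^ κ                          ≤⟨ *-mono-≤ c≤4 (<⇒≤ too-big) ⟩
        4 * (4 * k * k * (p * q))          ≤⟨ *-monoʳ-≤ 4 (*-monoʳ-≤ (4 * k * k) (*-monoˡ-≤ q p≤64k)) ⟩
        4 * (4 * k * k * (k * 64 * q))     ≤⟨ m≤n*m _ 4 ⟩
        4 * (4 * (4 * k * k * (k * 64 * q))) ≡⟨ rearrange k q ⟩
        loss k * q                         ∎
    ; upper = begin
        q                    ≤⟨ m≤n*m q (4 * k * k) ⟩
        4 * k * k * q        ≤⟨ fits ⟩
        c ^ κ                ≤⟨ ^-monoˡ-≤ κ c≤4 ⟩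
        4 ^ κ                ≤⟨ ^-monoʳ-≤ 4 (n≤1+n κ) ⟩
        4 ^ k                ∎
    }
    where
    k q : ℕ
    k = suc κ
    q = p ^ t
    instance
      q≢0 : NonZero q
      q≢0 = m^n≢0 p t {{prime⇒nonZero pp}}
    q-rigid : Rigid k q
    q-rigid = prime-power-rigid pp k≤p t
    colour : ∃[ f ] (∀ s d → q ∤ d → ¬ (∀ i j → i < k → j < k →
               lookup {A = Fin c} f ((s + i * d) mod q) ≡ lookup f ((s + j * d) mod q)))
    colour = cyclic-colouring κ c q-rigid (subst (_≤ c ^ κ) (*-assoc (4 * k) k q) fits)
    rearrange : ∀ k q → 4 * (4 * (4 * k * k * (k * 64 * q))) ≡ k * 16 * (k * 16 * (k * 16 * 1)) * q
    rearrange = solve-∀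

  APFree-∘ : ∀ {A B : Set} {k N} {f : ℕ → A} {φ : A → B} → (∀ {x y} → φ x ≡ φ y → x ≡ y) →
             APFree k N f → APFree k N (φ ∘ f)
  APFree-∘ φ-injective free s d 0<d in-range constant =
    free s d 0<d in-range (λ i j i<k j<k → φ-injective (constant i j i<k j<k))

  APFree-subst : ∀ {k N r r′} {f : ℕ → Fin r} (eq : r ≡ r′) → APFree k N f → APFree k N (subst (λ r → ℕ → Fin r) eq f)
  APFree-subst refl free = free

  join-injective : ∀ m n {x y : Fin m ⊎ Fin n} → join m n x ≡ join m n y → x ≡ y
  join-injective m n {x} {y} eq = trans (sym (Fin.splitAt-join m n x)) (trans (cong (splitAt m) eq) (Fin.splitAt-join m n y))

  -- `C ^ k` bounds every size that occurs, so one `p` and one `m` serve all steps: `C^k≤p^m`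
  -- provides enough digits, and `CCm<p` is the `k`-th root of the condition for the union bound.
  module Iterate (k : ℕ) (2≤k : 2 ≤ k) {p : ℕ} (pp : Prime p) (p≤k : p ≤ k) (m C : ℕ)
    (C^k≤p^m : C ^ k ≤ p ^ m) (CCm<p : C * C * m < p) (blocks : ∀ c → 2 ≤ c → c ≤ 4 → Block c k) where

    P : ℕ
    P = loss k

    iterate : ∀ a → 2 ≤ a → a ≤ 4 → ∀ b → 4 ^ suc b ≤ C →
      ∃[ N ] ∃[ f ] APFree {Fin (a + 3 * b)} k N f × (a * 3 ^ b) ^ k ≤ P ^ suc b * N × N ≤ (4 ^ suc b) ^ k
    iterate a 2≤a a≤4 zero _ = size , subst (λ r → ℕ → Fin r) (sym (+-identityʳ a)) f , APFree-subst {f = f} (sym (+-identityʳ a)) f-free , lower′ , upper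
      where
      open Block (blocks a 2≤a a≤4)
      instance _ = size≢0
      f : ℕ → Fin a
      f n = lookup colouring (n mod size)
      f-free : APFree k size f
      f-free s d 0<d in-range = free s d λ size∣d → <⇒≱ (≤-<-trans
        (≤-trans (≤-reflexive (sym (*-identityˡ d))) (m≤n+m (1 * d) s)) (in-range 1 2≤k))
        (∣⇒≤ {{>-nonZero 0<d}} size∣d)
      lower′ : (a * 1) ^ k ≤ P * 1 * size
      lower′ = subst₂ (λ x y → x ^ k ≤ y * size) (sym (*-identityʳ a)) (sym (*-identityʳ P)) lower
    iterate a 2≤a a≤4 (suc b) 4^≤C with iterate a 2≤a a≤4 b (≤-trans (m≤n*m (4 ^ suc b) 4) 4^≤C)
    ... | M , f , f-free , M-lower , M-upper = M * size , subst (λ r → ℕ → Fin r) r≡ (join (a + 3 * b) 3 ∘ proj₁ h) ,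
          APFree-subst r≡ (APFree-∘ {f = proj₁ h} (join-injective (a + 3 * b) 3) (proj₂ h)) , lower′ , upper′
      where
      open Block (blocks 3 (s≤s (s≤s z≤n)) (s≤s (s≤s (s≤s z≤n))))
      instance _ = size≢0
      r≡ : a + 3 * b + 3 ≡ a + 3 * suc b
      r≡ = rearrange a b
        where
        rearrange : ∀ a b → a + 3 * b + 3 ≡ a + 3 * suc b
        rearrange = solve-∀
      upper′ : M * size ≤ (4 ^ suc (suc b)) ^ k
      upper′ = begin
        M * size                        ≤⟨ *-mono-≤ M-upper upper ⟩
        (4 ^ suc b) ^ k * 4 ^ k         ≡⟨ *-comm ((4 ^ suc b) ^ k) (4 ^ k) ⟩
        4 ^ k * (4 ^ suc b) ^ k         ≡⟨ ^-distribʳ-* k 4 (4 ^ suc b) ⟨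
        (4 * 4 ^ suc b) ^ k             ∎
      lower′ : (a * (3 * 3 ^ b)) ^ k ≤ P * P ^ suc b * (M * size)
      lower′ = begin
        (a * (3 * 3 ^ b)) ^ k                     ≡⟨ cong (_^ k) (rearrange a (3 ^ b)) ⟩
        (3 * (a * 3 ^ b)) ^ k                     ≡⟨ ^-distribʳ-* k 3 (a * 3 ^ b) ⟩
        3 ^ k * (a * 3 ^ b) ^ k                   ≤⟨ *-mono-≤ lower M-lower ⟩
        P * size * (P ^ suc b * M)                ≡⟨ rearrange′ P size (P ^ suc b) M ⟩
        P * P ^ suc b * (M * size)                ∎
        where
        rearrange : ∀ a x → a * (3 * x) ≡ 3 * (a * x)
        rearrange = solve-∀
        rearrange′ : ∀ p s x m → p * s * (x * m) ≡ p * x * (m * s)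
        rearrange′ = solve-∀
      M≤C^k : M ≤ C ^ k
      M≤C^k = ≤-trans M-upper (^-monoˡ-≤ k (≤-trans (m≤n*m (4 ^ suc b) 4) 4^≤C))
      few : M * size * (M * size) * m ^ k < p ^ k
      few = begin-strict
        M * size * (M * size) * m ^ k       ≤⟨ *-monoˡ-≤ (m ^ k) (*-mono-≤ Mq≤C^k Mq≤C^k) ⟩
        C ^ k * C ^ k * m ^ k               ≡⟨ trans (cong (_* m ^ k) (sym (^-distribʳ-* k C C))) (sym (^-distribʳ-* k (C * C) m)) ⟩
        (C * C * m) ^ k                     <⟨ ^-monoˡ-< k {{>-nonZero (<-trans z<s 2≤k)}} CCm<p ⟩
        p ^ k                               ∎
        where
        Mq≤C^k : M * size ≤ C ^ k
        Mq≤C^k = ≤-trans upper′ (^-monoˡ-≤ k 4^≤C)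
      h : ∃[ h ] APFree {Fin (a + 3 * b) ⊎ Fin 3} k (M * size) h
      h = product-colouring {q = size} {m = m} 2≤k pp p≤k (≤-trans M≤C^k C^k≤p^m) rigid few f f-free colouring free

  3j+9≤2^j : ∀ x → 3 * (x + 5) + 9 ≤ 2 ^ (x + 5)
  3j+9≤2^j zero = ≤ᵇ⇒≤ 24 32 _
  3j+9≤2^j (suc x) = begin
    3 * (suc x + 5) + 9                             ≤⟨ m≤m+n _ (3 * x + 21) ⟩
    3 * (suc x + 5) + 9 + (3 * x + 21)              ≡⟨ rearrange x ⟩
    2 * (3 * (x + 5) + 9)                           ≤⟨ *-monoʳ-≤ 2 (3j+9≤2^j x) ⟩
    2 * 2 ^ (x + 5)                                 ∎
    where
    rearrange : ∀ x → 3 * (suc x + 5) + 9 + (3 * x + 21) ≡ 2 * (3 * (x + 5) + 9)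
    rearrange = solve-∀

  -- The loss is at most `4 ^ (3 * j + 9)`. In the exponent of its power both `3 * j + 9` and
  -- `2 * E` are at most `2 ^ j`, and two such factors make `4 ^ j ≤ k`.
  loss^≤2^ : ∀ E j k → 2 * E ≤ j → 5 ≤ j → 4 ^ j ≤ k → k ≤ 4 ^ suc j → loss k ^ E ≤ 2 ^ k
  loss^≤2^ E j k 2E≤j 5≤j 4^j≤k k≤4^1+j = begin
    ((k * 16) ^ 3) ^ E                 ≤⟨ ^-monoˡ-≤ E (^-monoˡ-≤ 3 (*-monoˡ-≤ 16 k≤4^1+j)) ⟩
    ((4 ^ suc j * 4 ^ 2) ^ 3) ^ E      ≡⟨ cong (λ z → (z ^ 3) ^ E) (^-distribˡ-+-* 4 (suc j) 2) ⟨
    ((4 ^ (suc j + 2)) ^ 3) ^ E        ≡⟨ cong (_^ E) (^-*-assoc 4 (suc j + 2) 3) ⟩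
    (4 ^ ((suc j + 2) * 3)) ^ E        ≡⟨ cong (λ z → (4 ^ z) ^ E) (rearrange j) ⟩
    (4 ^ (3 * j + 9)) ^ E              ≡⟨ cong (_^ E) (4^≡2^ (3 * j + 9)) ⟩
    (2 ^ (2 * (3 * j + 9))) ^ E        ≡⟨ ^-*-assoc 2 (2 * (3 * j + 9)) E ⟩
    2 ^ (2 * (3 * j + 9) * E)          ≤⟨ ^-monoʳ-≤ 2 exponent ⟩
    2 ^ k                              ∎
    where
    rearrange : ∀ j → (suc j + 2) * 3 ≡ 3 * j + 9
    rearrange = solve-∀
    exponent : 2 * (3 * j + 9) * E ≤ k
    exponent = begin
      2 * (3 * j + 9) * E              ≡⟨ commute (3 * j + 9) E ⟩
      (3 * j + 9) * (2 * E)            ≤⟨ *-mono-≤ (subst (λ z → 3 * z + 9 ≤ 2 ^ z) (m∸n+n≡m 5≤j) (3j+9≤2^j (j ∸ 5)))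
                                            (≤-trans 2E≤j (<⇒≤ (n<2^n j))) ⟩
      2 ^ j * 2 ^ j                    ≡⟨ 4^≡2^*2^ j ⟨
      4 ^ j                            ≤⟨ 4^j≤k ⟩
      k                                ∎
      where
      commute : ∀ x E → 2 * x * E ≡ x * (2 * E)
      commute = solve-∀

  -- The window is made for `∃prime`: at `i` it yields a prime at most `k`, and at `3 + i` a prime
  -- above `k`, both within a factor 64 of `k`.
  level : ∀ i₀ k → 4 ^ (i₀ + 2) < k → ∃[ i ] i₀ ≤ i × 4 ^ (2 + i) ≤ k × k < 4 ^ (3 + i)
  level i₀ k K<k =
    let t , 4^≤k , k<4^ = largest-power 4 (4 ^ (i₀ + 2)) k (s≤s (s≤s z≤n)) (m^n>0 4 (i₀ + 2)) (<⇒≤ K<k)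
    in i₀ + t , m≤m+n i₀ t , subst (_≤ k) (power t) 4^≤k ,
       subst (k <_) (trans (power (suc t)) (cong (λ z → 4 ^ (2 + z)) (+-suc i₀ t))) k<4^
    where
    power : ∀ x → 4 ^ (i₀ + 2) * 4 ^ x ≡ 4 ^ (2 + (i₀ + x))
    power x = trans (sym (^-distribˡ-+-* 4 (i₀ + 2) x)) (cong (4 ^_) (regroup i₀ x))
      where
      regroup : ∀ y x → y + 2 + x ≡ 2 + (y + x)
      regroup = solve-∀

  module AtLevel (a b ν : ℕ) (2≤a : 2 ≤ a) (a≤4 : a ≤ 4)
    (C G : ℕ) (2≤C : 2 ≤ C) (4^≤C : 4 ^ suc b ≤ C) (G≡ : suc (C * C) ≡ G) .{{_ : NonZero G}}
    (κ i : ℕ) (6≤i : 6 ≤ i) (C^128G≤4^i : C ^ (G * 128) ≤ 4 ^ i) (2E≤i : 2 * (suc b * suc ν) ≤ i)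
    (lo : 4 ^ (2 + i) ≤ suc κ) (hi : suc κ < 4 ^ (3 + i)) where

    k R E : ℕ
    k = suc κ
    R = a * 3 ^ b
    E = suc b * suc ν

    2≤R : 2 ≤ R
    2≤R = ≤-trans 2≤a (m≤m*n a (3 ^ b) {{m^n≢0 3 b}})

    small : ∃[ p ] Prime p × 4 ^ i < p × p ≤ 4 ^ (2 + i)
    small = ∃prime i 6≤i

    big : ∃[ p ] Prime p × 4 ^ (3 + i) < p × p ≤ 4 ^ (2 + (3 + i))
    big = ∃prime (3 + i) (≤-trans 6≤i (m≤n+m i 3))

    p : ℕ
    p = proj₁ small

    pp : Prime p
    pp = proj₁ (proj₂ small)

    4^i<p : 4 ^ i < p
    4^i<p = proj₁ (proj₂ (proj₂ small))

    p≤k : p ≤ k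
    p≤k = ≤-trans (proj₂ (proj₂ (proj₂ small))) lo

    2≤k : 2 ≤ k
    2≤k = ≤-trans (nonTrivial⇒n>1 p {{prime⇒nonTrivial pp}}) p≤k

    loss^E≤2^k : loss k ^ E ≤ 2 ^ k
    loss^E≤2^k = loss^≤2^ E (2 + i) k (≤-trans 2E≤i (m≤n+m i 2)) (≤-trans (≤-trans (n≤1+n 5) 6≤i) (m≤n+m i 2)) lo (<⇒≤ hi)

    4kk≤2^κ : 4 * k * k ≤ 2 ^ κ
    4kk≤2^κ = *-cancelˡ-≤ 2 (begin
      2 * (4 * k * k)                      ≤⟨ m≤n*m (2 * (4 * k * k)) (k * 512) ⟩
      k * 512 * (2 * (4 * k * k))          ≡⟨ rearrange k ⟩
      loss k                               ≡⟨ ^-identityʳ (loss k) ⟨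
      loss k ^ 1                           ≤⟨ ^-monoʳ-≤ (loss k) {{m^n≢0 (k * 16) 3}} {1} {E} (s≤s z≤n) ⟩
      loss k ^ E                           ≤⟨ loss^E≤2^k ⟩
      2 ^ k                                ∎)
      where
      rearrange : ∀ k → k * 512 * (2 * (4 * k * k)) ≡ k * 16 * (k * 16 * (k * 16 * 1))
      rearrange = solve-∀

    blocks : ∀ c → 2 ≤ c → c ≤ 4 → Block c k
    blocks c 2≤c c≤4 = block κ c (proj₁ (proj₂ big)) (<⇒≤ (<-trans hi (proj₁ (proj₂ (proj₂ big))))) p′≤64k
      {{>-nonZero (<-trans z<s 2≤c)}} c≤4 (≤-trans 4kk≤2^κ (^-monoˡ-≤ κ 2≤c))
      where
      p′≤64k : proj₁ big ≤ k * 64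
      p′≤64k = begin
        proj₁ big               ≤⟨ proj₂ (proj₂ (proj₂ big)) ⟩
        4 ^ (2 + (3 + i))       ≡⟨ cong (4 ^_) (+-comm 3 (2 + i)) ⟩
        4 ^ (2 + i + 3)         ≡⟨ ^-distribˡ-+-* 4 (2 + i) 3 ⟩
        4 ^ (2 + i) * 64        ≤⟨ *-monoˡ-≤ 64 lo ⟩
        k * 64                  ∎

    C^128G≤p : C ^ (G * 128) ≤ p
    C^128G≤p = ≤-trans C^128G≤4^i (<⇒≤ 4^i<p)

    -- With m = p / G digits the union bound needs C² m < p, and C ^ k ≤ p ^ m follows from
    -- k ≤ 64 p ≤ 128 G m and C ^ (128 G) ≤ p.
    m : ℕ
    m = p / G

    G≤p : G ≤ p
    G≤p = begin
      G                   ≤⟨ <⇒≤ (n<2^n G) ⟩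
      2 ^ G               ≤⟨ ^-monoˡ-≤ G 2≤C ⟩
      C ^ G               ≤⟨ ^-monoʳ-≤ C {{>-nonZero (<-trans z<s 2≤C)}} (m≤m*n G 128) ⟩
      C ^ (G * 128)       ≤⟨ C^128G≤p ⟩
      p                   ∎

    0<m : 0 < m
    0<m = m≥n⇒m/n>0 G≤p

    CCm<p : C * C * m < p
    CCm<p = begin-strict
      C * C * m           <⟨ m<n+m (C * C * m) 0<m ⟩
      suc (C * C) * m     ≡⟨ cong (_* m) G≡ ⟩
      G * m               ≡⟨ *-comm G m ⟩
      m * G               ≤⟨ m/n*n≤m p G ⟩
      p                   ∎

    k≤128Gm : k ≤ G * 128 * m
    k≤128Gm = begin
      k                           ≤⟨ <⇒≤ hi ⟩
      4 ^ (3 + i)                 ≡⟨ cong (4 ^_) (+-comm 3 i) ⟩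
      4 ^ (i + 3)                 ≡⟨ ^-distribˡ-+-* 4 i 3 ⟩
      4 ^ i * 64                  ≤⟨ *-monoˡ-≤ 64 (<⇒≤ 4^i<p) ⟩
      p * 64                      ≡⟨ cong (_* 64) (m≡m%n+[m/n]*n p G) ⟩
      (p % G + m * G) * 64        ≤⟨ *-monoˡ-≤ 64 (+-monoˡ-≤ (m * G) (≤-trans (m%n≤n p G) (m≤n*m G m {{>-nonZero 0<m}}))) ⟩
      (m * G + m * G) * 64        ≡⟨ rearrange m G ⟩
      G * 128 * m                 ∎
      where
      rearrange : ∀ m G → (m * G + m * G) * 64 ≡ G * 128 * m
      rearrange = solve-∀

    C^k≤p^m : C ^ k ≤ p ^ m
    C^k≤p^m = begin
      C ^ k                       ≤⟨ ^-monoʳ-≤ C {{>-nonZero (<-trans z<s 2≤C)}} k≤128Gm ⟩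
      C ^ (G * 128 * m)           ≡⟨ ^-*-assoc C (G * 128) m ⟨
      (C ^ (G * 128)) ^ m         ≤⟨ ^-monoˡ-≤ m C^128G≤p ⟩
      p ^ m                       ∎
    open Iterate k 2≤k pp p≤k m C C^k≤p^m CCm<p blocks

    -- In the power `suc ν` of the lower bound the losses of the `suc b` blocks multiply to `P ^ E`.
    -- This is at most `R ^ k`, so it costs one of the `suc ν` factors `R ^ k`.
    absorb-loss : ∀ N → R ^ k ≤ P ^ suc b * N → R ^ (ν * k) ≤ N ^ suc ν
    absorb-loss N lower = *-cancelˡ-≤ (R ^ k) {{m^n≢0 R k {{>-nonZero (<-trans z<s 2≤R)}}}} (begin
      R ^ k * R ^ (ν * k)                    ≡⟨ ^-distribˡ-+-* R k (ν * k) ⟨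
      R ^ (suc ν * k)                        ≡⟨ trans (cong (R ^_) (*-comm (suc ν) k)) (sym (^-*-assoc R k (suc ν))) ⟩
      (R ^ k) ^ suc ν                        ≤⟨ ^-monoˡ-≤ (suc ν) lower ⟩
      (P ^ suc b * N) ^ suc ν                ≡⟨ ^-distribʳ-* (suc ν) (P ^ suc b) N ⟩
      (P ^ suc b) ^ suc ν * N ^ suc ν        ≡⟨ cong (_* N ^ suc ν) (^-*-assoc P (suc b) (suc ν)) ⟩
      P ^ E * N ^ suc ν                      ≤⟨ *-monoˡ-≤ (N ^ suc ν) (≤-trans loss^E≤2^k (^-monoˡ-≤ k 2≤R)) ⟩
      R ^ k * N ^ suc ν                      ∎)

    colouring-at : ∃[ N ] ∃[ f ] APFree {Fin (a + 3 * b)} k N f × R ^ (ν * k) ≤ N ^ suc ν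
    colouring-at =
      let N , f , f-free , lower , _ = iterate a 2≤a a≤4 b 4^≤C
      in N , f , f-free , absorb-loss N lower

  -- The size condition is `(a * 3 ^ b) ^ ((1 - 1 / (1 + ν)) * k) ≤ N`, with the root cleared.
  Colourable : ℕ → ℕ → ℕ → ℕ → Set
  Colourable a b ν k = ∃[ N ] ∃[ f ] APFree {Fin (a + 3 * b)} k N f × (a * 3 ^ b) ^ (ν * k) ≤ N ^ suc ν

  beyond-level : ∀ a b ν → 2 ≤ a → a ≤ 4 → ∀ C G → 2 ≤ C → 4 ^ suc b ≡ C → suc (C * C) ≡ G →
    ∀ i₀ → 6 ≤ i₀ → suc b * (G * 128) ≤ i₀ → 2 * (suc b * suc ν) ≤ i₀ →
    ∃[ K ] (∀ k → K < k → Colourable a b ν k)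
  beyond-level a b ν 2≤a a≤4 C G 2≤C 4^≡C G≡ i₀ 6≤i₀ ≤i₀ 2E≤i₀ = 4 ^ (i₀ + 2) , beyond
    where
    instance _ = >-nonZero (subst (0 <_) G≡ z<s)
    C^128G≤ : C ^ (G * 128) ≤ 4 ^ i₀
    C^128G≤ = ≤-trans (≤-reflexive (trans (cong (_^ (G * 128)) (sym 4^≡C)) (^-*-assoc 4 (suc b) (G * 128))))
                      (^-monoʳ-≤ 4 ≤i₀)
    beyond : ∀ k → 4 ^ (i₀ + 2) < k → Colourable a b ν k
    beyond (suc κ) K<k = let i , i₀≤i , lo , hi = level i₀ (suc κ) K<k in
      AtLevel.colouring-at a b ν 2≤a a≤4 C G 2≤C (≤-reflexive 4^≡C) G≡ κ i
        (≤-trans 6≤i₀ i₀≤i) (≤-trans C^128G≤ (^-monoʳ-≤ 4 i₀≤i)) (≤-trans 2E≤i₀ i₀≤i) lo hi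

  common-bound : ∀ x y z → ∃[ u ] x ≤ u × y ≤ u × z ≤ u
  common-bound x y z = x ⊔ (y ⊔ z) , m≤m⊔n x (y ⊔ z) ,
    ≤-trans (m≤m⊔n y z) (m≤n⊔m x (y ⊔ z)) , ≤-trans (m≤n⊔m y z) (m≤n⊔m x (y ⊔ z))

  colouring-exists : ∀ a b ν → 2 ≤ a → a ≤ 4 → ∃[ K ] (∀ k → K < k → Colourable a b ν k)
  colouring-exists a b ν 2≤a a≤4 = from (4 ^ suc b) (suc (4 ^ suc b * 4 ^ suc b)) 2≤4^ refl refl
      (common-bound 6 (suc b * (suc (4 ^ suc b * 4 ^ suc b) * 128)) (2 * (suc b * suc ν)))
    where
    2≤4^ : 2 ≤ 4 ^ suc b
    2≤4^ = ≤-trans (s≤s (s≤s z≤n)) (m≤m*n 4 (4 ^ b) {{m^n≢0 4 b}})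
    from : ∀ C G → 2 ≤ C → 4 ^ suc b ≡ C → suc (C * C) ≡ G →
           ∃[ i₀ ] 6 ≤ i₀ × suc b * (G * 128) ≤ i₀ × 2 * (suc b * suc ν) ≤ i₀ →
           ∃[ K ] (∀ k → K < k → Colourable a b ν k)
    from C G 2≤C 4^≡C G≡ (i₀ , 6≤i₀ , i₁≤i₀ , i₂≤i₀) = beyond-level a b ν 2≤a a≤4 C G 2≤C 4^≡C G≡ i₀ 6≤i₀ i₁≤i₀ i₂≤i₀

-- Rational exponents, integer progressions and the two final bounds.

open import Defs
open Products
open Parameters
open import Data.Nat using (ℕ; zero; suc; NonZero; _≤_; _<_; _+_; _*_; _^_; _∸_; z≤n; s≤s; z<s; >-nonZero)
open import Data.Nat.Properties
open import Data.Nat.DivMod using (_%_; _/_; m≡m%n+[m/n]*n; m%n<n)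
import Data.Nat.Tactic.RingSolver as ℕ-Solver
open import Data.Integer as ℤ using (ℤ; +_; -[1+_])
import Data.Integer.Properties as ℤ
open import Data.Integer.GCD using (gcd)
open import Data.Integer.Tactic.RingSolver using (solve-∀)
open import Data.Rational as ℚ using (ℚ; 0ℚ; 1ℚ; ↥_; ↧_; ↧ₙ_)
import Data.Rational.Properties as ℚ
open import Data.Fin using (Fin; toℕ; fromℕ<; opposite)
import Data.Fin as Fin
import Data.Fin.Properties as Fin
open import Data.Product using (_×_; _,_; proj₁; proj₂; ∃-syntax)
open import Data.Sum using (_⊎_; inj₁; inj₂)
open import Relation.Nullary
open import Relation.Nullary.Decidable using (from-yes)
open import Relation.Binary.PropositionalEquality

⁺-≤ : ∀ {i m} → i ℤ.≤ + m → i ⁺ ≤ m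
⁺-≤ {+ _}      (ℤ.+≤+ n≤m) = n≤m
⁺-≤ { -[1+ _ ]} _          = z≤n

⁺-* : ∀ i n → (i ℤ.* + n) ⁺ ≡ i ⁺ * n
⁺-* (+ m)    n       = cong _⁺ (sym (ℤ.pos-* m n))
⁺-* -[1+ m ] zero    = refl′ (ℤ.*-zeroʳ -[1+ m ])
  where
  refl′ : ∀ {i} → i ≡ + 0 → i ⁺ ≡ 0
  refl′ refl = refl
⁺-* -[1+ m ] (suc n) = refl

-- Rationals are kept in lowest terms, whereas the exponents arise as unreduced quotients;
-- cross-multiplication relates the two without computing a gcd.
record Fraction (p : ℚ) (i j : ℤ) : Set where
  constructor fraction
  field cross-multiplied : ↥ p ℤ.* j ≡ i ℤ.* ↧ p

cross : ∀ {i j g I J} → i ℤ.* g ≡ I → j ℤ.* g ≡ J → i ℤ.* J ≡ I ℤ.* j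
cross {i} {j} {g} refl refl = rearrange i j g
  where
  rearrange : ∀ i j g → i ℤ.* (j ℤ.* g) ≡ i ℤ.* g ℤ.* j
  rearrange = solve-∀

fraction-/ : ∀ i n .{{_ : NonZero n}} → Fraction (i ℚ./ n) i (+ n)
fraction-/ i n = fraction (cross {↥ (i ℚ./ n)} {↧ (i ℚ./ n)} {gcd i (+ n)} (ℚ.↥-/ i n) (ℚ.↧-/ i n))

fraction-neg : ∀ {p i j} → Fraction p i j → Fraction (ℚ.- p) (ℤ.- i) j
fraction-neg {p} {i} {j} (fraction p≡i/j) = fraction (begin
  ↥ (ℚ.- p) ℤ.* j       ≡⟨ cong (ℤ._* j) (ℚ.↥-neg p) ⟩
  (ℤ.- ↥ p) ℤ.* j       ≡⟨ ℤ.neg-distribˡ-* (↥ p) j ⟨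
  ℤ.- (↥ p ℤ.* j)       ≡⟨ cong ℤ.-_ p≡i/j ⟩
  ℤ.- (i ℤ.* ↧ p)       ≡⟨ ℤ.neg-distribˡ-* i (↧ p) ⟩
  (ℤ.- i) ℤ.* ↧ p       ≡⟨ cong ((ℤ.- i) ℤ.*_) (ℚ.↧-neg p) ⟨
  (ℤ.- i) ℤ.* ↧ (ℚ.- p) ∎)
  where open ≡-Reasoning

fraction-* : ∀ {p q i j i′ j′} → Fraction p i j → Fraction q i′ j′ → Fraction (p ℚ.* q) (i ℤ.* i′) (j ℤ.* j′)
fraction-* {p} {q} {i} {j} {i′} {j′} (fraction p≡) (fraction q≡) = fraction (ℤ.*-cancelʳ-≡ _ _ (↧ p ℤ.* ↧ q) (begin
  ↥ x ℤ.* (j ℤ.* j′) ℤ.* (↧ p ℤ.* ↧ q)       ≡⟨ first (↥ x) (j ℤ.* j′) (↧ p ℤ.* ↧ q) ⟩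
  ↥ x ℤ.* (↧ p ℤ.* ↧ q) ℤ.* (j ℤ.* j′)       ≡⟨ cong (ℤ._* (j ℤ.* j′)) (cross {↥ x} {↧ x} {gcd (↥ p ℤ.* ↥ q) (↧ p ℤ.* ↧ q)} (ℚ.↥-* p q) (ℚ.↧-* p q)) ⟩
  ↥ p ℤ.* ↥ q ℤ.* ↧ x ℤ.* (j ℤ.* j′)         ≡⟨ second (↥ p) (↥ q) (↧ x) j j′ ⟩
  (↥ p ℤ.* j) ℤ.* (↥ q ℤ.* j′) ℤ.* ↧ x       ≡⟨ cong₂ (λ y z → y ℤ.* z ℤ.* ↧ x) p≡ q≡ ⟩
  (i ℤ.* ↧ p) ℤ.* (i′ ℤ.* ↧ q) ℤ.* ↧ x       ≡⟨ third i (↧ p) i′ (↧ q) (↧ x) ⟩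
  i ℤ.* i′ ℤ.* ↧ x ℤ.* (↧ p ℤ.* ↧ q)         ∎))
  where
  open ≡-Reasoning
  x : ℚ
  x = p ℚ.* q
  first : ∀ a b c → a ℤ.* b ℤ.* c ≡ a ℤ.* c ℤ.* b
  first = solve-∀
  second : ∀ a b d e f → a ℤ.* b ℤ.* d ℤ.* (e ℤ.* f) ≡ (a ℤ.* e) ℤ.* (b ℤ.* f) ℤ.* d
  second = solve-∀
  third : ∀ a b d e f → (a ℤ.* b) ℤ.* (d ℤ.* e) ℤ.* f ≡ a ℤ.* d ℤ.* f ℤ.* (b ℤ.* e)
  third = solve-∀

fraction-+ : ∀ {p q i j i′ j′} → Fraction p i j → Fraction q i′ j′ →
             Fraction (p ℚ.+ q) (i ℤ.* j′ ℤ.+ i′ ℤ.* j) (j ℤ.* j′)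
fraction-+ {p} {q} {i} {j} {i′} {j′} (fraction p≡) (fraction q≡) = fraction (ℤ.*-cancelʳ-≡ _ _ (↧ p ℤ.* ↧ q) (begin
  ↥ x ℤ.* (j ℤ.* j′) ℤ.* (↧ p ℤ.* ↧ q)       ≡⟨ first (↥ x) (j ℤ.* j′) (↧ p ℤ.* ↧ q) ⟩
  ↥ x ℤ.* (↧ p ℤ.* ↧ q) ℤ.* (j ℤ.* j′)       ≡⟨ cong (ℤ._* (j ℤ.* j′)) (cross {↥ x} {↧ x} {gcd (↥ p ℤ.* ↧ q ℤ.+ ↥ q ℤ.* ↧ p) (↧ p ℤ.* ↧ q)} (ℚ.↥-+ p q) (ℚ.↧-+ p q)) ⟩
  (↥ p ℤ.* ↧ q ℤ.+ ↥ q ℤ.* ↧ p) ℤ.* ↧ x ℤ.* (j ℤ.* j′)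
                                             ≡⟨ second (↥ p) (↧ p) (↥ q) (↧ q) (↧ x) j j′ ⟩
  ((↥ p ℤ.* j) ℤ.* (↧ q ℤ.* j′) ℤ.+ (↥ q ℤ.* j′) ℤ.* (↧ p ℤ.* j)) ℤ.* ↧ x
                                             ≡⟨ cong₂ (λ y z → (y ℤ.* (↧ q ℤ.* j′) ℤ.+ z ℤ.* (↧ p ℤ.* j)) ℤ.* ↧ x) p≡ q≡ ⟩
  ((i ℤ.* ↧ p) ℤ.* (↧ q ℤ.* j′) ℤ.+ (i′ ℤ.* ↧ q) ℤ.* (↧ p ℤ.* j)) ℤ.* ↧ x
                                             ≡⟨ third i j i′ j′ (↧ p) (↧ q) (↧ x) ⟩
  (i ℤ.* j′ ℤ.+ i′ ℤ.* j) ℤ.* ↧ x ℤ.* (↧ p ℤ.* ↧ q) ∎))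
  where
  open ≡-Reasoning
  x : ℚ
  x = p ℚ.+ q
  first : ∀ a b c → a ℤ.* b ℤ.* c ≡ a ℤ.* c ℤ.* b
  first = solve-∀
  second : ∀ a b d e f j k → (a ℤ.* e ℤ.+ d ℤ.* b) ℤ.* f ℤ.* (j ℤ.* k) ≡
                             ((a ℤ.* j) ℤ.* (e ℤ.* k) ℤ.+ (d ℤ.* k) ℤ.* (b ℤ.* j)) ℤ.* f
  second = solve-∀
  third : ∀ a b d e f g h → ((a ℤ.* f) ℤ.* (g ℤ.* e) ℤ.+ (d ℤ.* g) ℤ.* (f ℤ.* b)) ℤ.* h ≡
                            (a ℤ.* e ℤ.+ d ℤ.* b) ℤ.* h ℤ.* (f ℤ.* g)
  third = solve-∀

^-cancel-< : ∀ n {a b} → a ^ n < b ^ n → a < b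
^-cancel-< n aⁿ<bⁿ = ≰⇒> λ b≤a → <⇒≱ aⁿ<bⁿ (^-monoˡ-≤ n b≤a)

^-cancel-≤ : ∀ n {a b} .{{_ : NonZero n}} → a ^ n ≤ b ^ n → a ≤ b
^-cancel-≤ n aⁿ≤bⁿ = ≮⇒≥ λ b<a → <⇒≱ (^-monoˡ-< n b<a) aⁿ≤bⁿ

^-commute : ∀ m a b → (m ^ a) ^ b ≡ (m ^ b) ^ a
^-commute m a b = trans (^-*-assoc m a b) (trans (cong (m ^_) (*-comm a b)) (sym (^-*-assoc m b a)))

positive-part-≤ : ∀ {x i m} n → Fraction x i (+ n) → i ℤ.≤ + m → (↥ x) ⁺ * n ≤ m * ↧ₙ x
positive-part-≤ {x} {i} {m} n (fraction x≡) i≤m = subst (_≤ m * ↧ₙ x) (⁺-* (↥ x) n) (⁺-≤ (begin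
  ↥ x ℤ.* + n         ≡⟨ x≡ ⟩
  i ℤ.* ↧ x           ≤⟨ ℤ.*-monoʳ-≤-nonNeg (↧ x) i≤m ⟩
  + m ℤ.* ↧ x         ≡⟨ ℤ.pos-* m (↧ₙ x) ⟨
  + (m * ↧ₙ x)        ∎))
  where open ℤ.≤-Reasoning

-- As `x ≤ m / n`, the comparison of `n`-th powers follows from the power `↧ₙ x` of `R ^ m < w ^ n`.
-- A negative numerator only enlarges the right-hand side.
↑-< : ∀ {R w x i m} n .{{_ : NonZero R}} → Fraction x i (+ n) → i ℤ.≤ + m → R ^ m < w ^ n → R ↑ x < w
↑-< {R} {w} {x} {i} {m} n x≡ i≤m R^m<w^n =
  subst₂ (λ u v → R ^ u ⁺ * w ^ v ⁻ < w ^ v ⁺ * R ^ u ⁻)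
    (sym (ℤ.*-identityʳ (↥ x))) (sym (ℤ.*-identityˡ (↧ x))) (begin-strict
      R ^ ↥ x ⁺ * 1             ≡⟨ *-identityʳ (R ^ ↥ x ⁺) ⟩
      R ^ ↥ x ⁺                 <⟨ ^-cancel-< n small ⟩
      w ^ ↧ₙ x                  ≤⟨ m≤m*n (w ^ ↧ₙ x) (R ^ ↥ x ⁻) {{m^n≢0 R (↥ x ⁻)}} ⟩
      w ^ ↧ₙ x * R ^ ↥ x ⁻      ∎)
  where
  open ≤-Reasoning
  small : (R ^ ↥ x ⁺) ^ n < (w ^ ↧ₙ x) ^ n
  small = begin-strict
    (R ^ ↥ x ⁺) ^ n        ≡⟨ ^-*-assoc R (↥ x ⁺) n ⟩
    R ^ (↥ x ⁺ * n)        ≤⟨ ^-monoʳ-≤ R (positive-part-≤ {x} n x≡ i≤m) ⟩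
    R ^ (m * ↧ₙ x)         ≡⟨ ^-*-assoc R m (↧ₙ x) ⟨
    (R ^ m) ^ ↧ₙ x         <⟨ ^-monoˡ-< (↧ₙ x) R^m<w^n ⟩
    (w ^ n) ^ ↧ₙ x         ≡⟨ ^-commute w n (↧ₙ x) ⟩
    (w ^ ↧ₙ x) ^ n         ∎

positive-numerator : ∀ {y c r} .{{_ : NonZero c}} → Fraction y (+ c) (+ r) → ∃[ Y ] ↥ y ≡ + Y × Y * r ≡ c * ↧ₙ y
positive-numerator {y} {suc c} {r} (fraction y≡) = go (↥ y) y≡
  where
  go : ∀ i → i ℤ.* + r ≡ + suc c ℤ.* ↧ y → ∃[ Y ] i ≡ + Y × Y * r ≡ suc c * ↧ₙ y
  go (+ Y)    eq = Y , refl , ℤ.+-injective (trans (ℤ.pos-* Y r) eq)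
  go -[1+ Y ] eq = contradiction
    (trans (sym (⁺-* -[1+ Y ] r)) (cong _⁺ eq)) (λ ())

-- The last hypothesis is `e ≤ (c / r) * log₂ N` with denominators cleared. Since `y` is stored
-- reduced, the goal is compared after raising to the power `r`, where `Y * r` turns into
-- `c * ↧ₙ y`.
≤*log₂-intro : ∀ {x y i e c r N} .{{_ : NonZero c}} .{{_ : NonZero r}} → 1 ≤ N →
  Fraction x i (+ 1) → i ℤ.≤ + e → Fraction y (+ c) (+ r) → 2 ^ (r * e) ≤ N ^ c → x ≤ y *log₂ N
≤*log₂-intro {x} {y} {i} {e} {c} {r} {N} 1≤N x≡ i≤e y≡ 2^re≤N^c =
  let Y , ↥y≡Y , Yr≡cD = positive-numerator {y} y≡
  in subst (λ v → 2 ^ u ⁺ * N ^ v ⁻ ≤ N ^ v ⁺ * 2 ^ u ⁻)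
       (trans (ℤ.pos-* Y (↧ₙ x)) (cong (ℤ._* ↧ x) (sym ↥y≡Y))) (begin
         2 ^ u ⁺ * 1                      ≡⟨ *-identityʳ (2 ^ u ⁺) ⟩
         2 ^ u ⁺                          ≤⟨ ^-cancel-≤ r (small Y Yr≡cD) ⟩
         N ^ (Y * ↧ₙ x)                   ≤⟨ m≤m*n (N ^ (Y * ↧ₙ x)) (2 ^ u ⁻) {{m^n≢0 2 (u ⁻)}} ⟩
         N ^ (Y * ↧ₙ x) * 2 ^ u ⁻         ∎)
  where
  open ≤-Reasoning
  instance _ = >-nonZero 1≤N
  u : ℤ
  u = ↥ x ℤ.* ↧ y
  u⁺≤ : u ⁺ ≤ e * ↧ₙ x * ↧ₙ y
  u⁺≤ = begin
    u ⁺                   ≡⟨ ⁺-* (↥ x) (↧ₙ y) ⟩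
    ↥ x ⁺ * ↧ₙ y          ≡⟨ cong (_* ↧ₙ y) (*-identityʳ (↥ x ⁺)) ⟨
    ↥ x ⁺ * 1 * ↧ₙ y      ≤⟨ *-monoˡ-≤ (↧ₙ y) (positive-part-≤ {x} 1 x≡ i≤e) ⟩
    e * ↧ₙ x * ↧ₙ y       ∎
  small : ∀ Y → Y * r ≡ c * ↧ₙ y → (2 ^ u ⁺) ^ r ≤ (N ^ (Y * ↧ₙ x)) ^ r
  small Y Yr≡cD = begin
    (2 ^ u ⁺) ^ r                    ≤⟨ ^-monoˡ-≤ r (^-monoʳ-≤ 2 u⁺≤) ⟩
    (2 ^ (e * ↧ₙ x * ↧ₙ y)) ^ r      ≡⟨ ^-*-assoc 2 (e * ↧ₙ x * ↧ₙ y) r ⟩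
    2 ^ (e * ↧ₙ x * ↧ₙ y * r)        ≡⟨ cong (2 ^_) (first e (↧ₙ x) (↧ₙ y) r) ⟩
    2 ^ (r * e * (↧ₙ x * ↧ₙ y))      ≡⟨ ^-*-assoc 2 (r * e) (↧ₙ x * ↧ₙ y) ⟨
    (2 ^ (r * e)) ^ (↧ₙ x * ↧ₙ y)    ≤⟨ ^-monoˡ-≤ (↧ₙ x * ↧ₙ y) 2^re≤N^c ⟩
    (N ^ c) ^ (↧ₙ x * ↧ₙ y)          ≡⟨ ^-*-assoc N c (↧ₙ x * ↧ₙ y) ⟩
    N ^ (c * (↧ₙ x * ↧ₙ y))          ≡⟨ cong (N ^_) (second c (↧ₙ x) (↧ₙ y)) ⟩
    N ^ (c * ↧ₙ y * ↧ₙ x)            ≡⟨ cong (λ z → N ^ (z * ↧ₙ x)) Yr≡cD ⟨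
    N ^ (Y * r * ↧ₙ x)               ≡⟨ cong (N ^_) (third Y r (↧ₙ x)) ⟩
    N ^ (Y * ↧ₙ x * r)               ≡⟨ ^-*-assoc N (Y * ↧ₙ x) r ⟨
    (N ^ (Y * ↧ₙ x)) ^ r             ∎
    where
    first : ∀ e d d′ r → e * d * d′ * r ≡ r * e * (d * d′)
    first = ℕ-Solver.solve-∀
    second : ∀ c d d′ → c * (d * d′) ≡ c * d′ * d
    second = ℕ-Solver.solve-∀
    third : ∀ Y r d → Y * r * d ≡ Y * d * r
    third = ℕ-Solver.solve-∀

-- `HasMonoAP` allows negative differences while `APFree` speaks of positive ones, so a decreasing
-- progression is read from its other end.
reverse-AP : ∀ {r N κ} {c : Coloring r N} x d j →
  ((i : Fin (suc κ)) → ∃[ m ] ⟦ m ⟧ ≡ x ℤ.+ + toℕ i ℤ.* d × c m ≡ j) →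
  (i : Fin (suc κ)) → ∃[ m ] ⟦ m ⟧ ≡ (x ℤ.+ + κ ℤ.* d) ℤ.+ + toℕ i ℤ.* (ℤ.- d) × c m ≡ j
reverse-AP {κ = κ} x d j terms i =
  let m , m≡ , cm≡j = terms (opposite i)
  in m , trans m≡ (begin
       x ℤ.+ + toℕ (opposite i) ℤ.* d                 ≡⟨ cong (λ z → x ℤ.+ + z ℤ.* d) (Fin.opposite-prop i) ⟩
       x ℤ.+ + (κ ∸ toℕ i) ℤ.* d                      ≡⟨ cancel x (+ (κ ∸ toℕ i)) (+ toℕ i) d ⟩
       (x ℤ.+ (+ (κ ∸ toℕ i) ℤ.+ + toℕ i) ℤ.* d) ℤ.+ + toℕ i ℤ.* (ℤ.- d)
                                                      ≡⟨ cong (λ z → (x ℤ.+ + z ℤ.* d) ℤ.+ + toℕ i ℤ.* (ℤ.- d)) (m∸n+n≡m (Fin.toℕ≤pred[n] i)) ⟩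
       (x ℤ.+ + κ ℤ.* d) ℤ.+ + toℕ i ℤ.* (ℤ.- d)      ∎) , cm≡j
  where
  open ≡-Reasoning
  cancel : ∀ x a b d → x ℤ.+ a ℤ.* d ≡ (x ℤ.+ (a ℤ.+ b) ℤ.* d) ℤ.+ b ℤ.* (ℤ.- d)
  cancel = solve-∀

module _ {r M κ} (f : ℕ → Fin r) (free : APFree (suc κ) M f) {N} (N≤M : N ≤ M) where

  restriction : Coloring r N
  restriction m = f (toℕ m)

  no-increasing-AP : ∀ x e j →
    ¬ ((i : Fin (suc κ)) → ∃[ m ] ⟦ m ⟧ ≡ x ℤ.+ + toℕ i ℤ.* + suc e × restriction m ≡ j)
  no-increasing-AP x e j terms = free (term 0F) (suc e) z<s in-range constant
    where
    0F : Fin (suc κ)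
    0F = Fin.zero
    term : Fin (suc κ) → ℕ
    term i = toℕ (proj₁ (terms i))
    term-≡ : ∀ i → term i ≡ term 0F + toℕ i * suc e
    -- The shift by one in `⟦_⟧` occurs on both sides and cancels.
    term-≡ i = suc-injective (ℤ.+-injective (begin
      + suc (term i)                                    ≡⟨ proj₁ (proj₂ (terms i)) ⟩
      x ℤ.+ + toℕ i ℤ.* + suc e                         ≡⟨ cong (ℤ._+ + toℕ i ℤ.* + suc e) (sym (trans (proj₁ (proj₂ (terms 0F))) (ℤ.+-identityʳ x))) ⟩
      + suc (term 0F) ℤ.+ + toℕ i ℤ.* + suc e           ≡⟨ cong (ℤ._+_ (+ suc (term 0F))) (ℤ.pos-* (toℕ i) (suc e)) ⟨
      + suc (term 0F) ℤ.+ + (toℕ i * suc e)             ∎))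
      where open ≡-Reasoning
    at : ∀ {i} (i<k : i < suc κ) → term (fromℕ< i<k) ≡ term 0F + i * suc e
    at i<k = trans (term-≡ (fromℕ< i<k)) (cong (λ z → term 0F + z * suc e) (Fin.toℕ-fromℕ< i<k))
    in-range : ∀ i → i < suc κ → term 0F + i * suc e < M
    in-range i i<k = subst (_< M) (at i<k) (<-≤-trans (Fin.toℕ<n (proj₁ (terms (fromℕ< i<k)))) N≤M)
    colour : ∀ {i} → i < suc κ → f (term 0F + i * suc e) ≡ j
    colour i<k = trans (cong f (sym (at i<k))) (proj₂ (proj₂ (terms (fromℕ< i<k))))
    constant : Constant (suc κ) (λ i → f (term 0F + i * suc e))
    constant i i′ i<k i′<k = trans (colour i<k) (sym (colour i′<k))

  no-mono-AP : ¬ HasMonoAP (suc κ) restriction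
  no-mono-AP (x , + zero     , d≢0 , _)         = d≢0 refl
  no-mono-AP (x , + suc e    , _   , j , terms) = no-increasing-AP x e j terms
  no-mono-AP (x , -[1+ e ]   , _   , j , terms) =
    no-increasing-AP (x ℤ.+ + κ ℤ.* -[1+ e ]) e j (reverse-AP {c = restriction} x -[1+ e ] j terms)

lower-bound : ∀ a b → 2 ≤ a → a ≤ 4 → ∀ η → 0ℚ ℚ.< η →
  ∃[ K ] (∀ k → K < k → ∀ w → Is-w k (a + 3 * b) w → (a * 3 ^ b) ↑ ((1ℚ ℚ.- η) ℚ.* fromℕ k) < w)
lower-bound a b 2≤a a≤4 η 0<η =
  let K , colourable = colouring-exists a b ν 2≤a a≤4 in K , λ k K<k w w-least → bound k w w-least (colourable k K<k) (≤-<-trans z≤n K<k)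
  where
  ν R : ℕ
  -- The numerator of `η` is at least 1, so `η ≥ 1 / (1 + ν)` and `1 - η ≤ ν / (1 + ν)`.
  ν = ℕ.pred (↧ₙ η)
    where open import Data.Nat as ℕ
  R = a * 3 ^ b
  instance
    R≢0 : NonZero R
    R≢0 = m*n≢0 a (3 ^ b) {{>-nonZero (<-trans z<s 2≤a)}} {{m^n≢0 3 b}}
  numerator : ∃[ p ] ↥ η ≡ + suc p
  numerator = go (↥ η) (subst₂ ℤ._<_ (ℤ.*-zeroˡ (↧ η)) (ℤ.*-identityʳ (↥ η)) (ℚ.drop-*<* 0<η))
    where
    go : ∀ i → + 0 ℤ.< i → ∃[ p ] i ≡ + suc p
    go (+ suc p) _ = p , refl
    go (+ zero) (ℤ.+<+ ())
  exponent : ∀ k → Fraction ((1ℚ ℚ.- η) ℚ.* fromℕ k) ((+ suc ν ℤ.- ↥ η) ℤ.* + k) (+ suc ν)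
  exponent k = subst₂ (Fraction ((1ℚ ℚ.- η) ℚ.* fromℕ k)) (first (↧ η) (↥ η) (+ k)) (second (↧ η))
    (fraction-* (fraction-+ (fraction {1ℚ} {+ 1} {+ 1} refl) (fraction-neg (fraction {η} {↥ η} {↧ η} refl))) (fraction-/ (+ k) 1))
    where
    first : ∀ n p k → (+ 1 ℤ.* n ℤ.+ (ℤ.- p) ℤ.* + 1) ℤ.* k ≡ (n ℤ.- p) ℤ.* k
    first = solve-∀
    second : ∀ n → + 1 ℤ.* n ℤ.* + 1 ≡ n
    second = solve-∀
  exponent≤ : ∀ k → (+ suc ν ℤ.- ↥ η) ℤ.* + k ℤ.≤ + (ν * k)
  exponent≤ k = let p , ↥η≡ = numerator in begin
    (+ suc ν ℤ.- ↥ η) ℤ.* + k          ≡⟨ cong (λ z → (+ suc ν ℤ.- z) ℤ.* + k) ↥η≡ ⟩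
    (+ suc ν ℤ.- + suc p) ℤ.* + k      ≤⟨ ℤ.*-monoʳ-≤-nonNeg (+ k) (subst (ℤ._≤ + ν) (sym (trans (ℤ.[+m]-[+n]≡m⊖n (suc ν) (suc p)) (ℤ.[1+m]⊖[1+n]≡m⊖n ν p))) (ℤ.m⊖n≤m ν p)) ⟩
    + ν ℤ.* + k                        ≡⟨ ℤ.pos-* ν k ⟨
    + (ν * k)                          ∎
    where open ℤ.≤-Reasoning
  bound : ∀ k w → Is-w k (a + 3 * b) w → Colourable a b ν k → 0 < k → R ↑ ((1ℚ ℚ.- η) ℚ.* fromℕ k) < w
  bound (suc κ) w (w-good , _) (N , f , f-free , R^≤) _ = ↑-< {R} {w} (suc ν) (exponent (suc κ)) (exponent≤ (suc κ))
    -- If `w ≤ N`, the restricted colouring would contradict `w-good`; hence `N < w`.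
    (≤-<-trans R^≤ (^-monoˡ-< (suc ν) (≰⇒> λ w≤N → no-mono-AP f f-free w≤N (w-good (restriction f f-free w≤N)))))

2^a≤a*a : ∀ a → a ≡ 2 ⊎ a ≡ 3 ⊎ a ≡ 4 → 2 ^ a ≤ a * a
2^a≤a*a _ (inj₁ refl)        = ≤-refl
2^a≤a*a _ (inj₂ (inj₁ refl)) = n≤1+n 8
2^a≤a*a _ (inj₂ (inj₂ refl)) = ≤-refl

range : ∀ {a} → a ≡ 2 ⊎ a ≡ 3 ⊎ a ≡ 4 → 2 ≤ a × a ≤ 4
range (inj₁ refl)        = ≤-refl , m≤m+n 2 2
range (inj₂ (inj₁ refl)) = n≤1+n 2 , n≤1+n 3
range (inj₂ (inj₂ refl)) = m≤m+n 2 2 , ≤-refl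

-- Three colours contribute `8 ≤ 9`, and the initial `a` colours give `4 ≤ 4`, `8 ≤ 9` or `16 ≤ 16`.
2^r≤R² : ∀ a b → a ≡ 2 ⊎ a ≡ 3 ⊎ a ≡ 4 → 2 ^ (a + 3 * b) ≤ (a * 3 ^ b) ^ 2
2^r≤R² a b a∈ = begin
  2 ^ (a + 3 * b)              ≡⟨ ^-distribˡ-+-* 2 a (3 * b) ⟩
  2 ^ a * 2 ^ (3 * b)          ≡⟨ cong (2 ^ a *_) (^-*-assoc 2 3 b) ⟨
  2 ^ a * 8 ^ b                ≤⟨ *-mono-≤ (2^a≤a*a a a∈) (^-monoˡ-≤ b (n≤1+n 8)) ⟩
  a * a * 9 ^ b                ≡⟨ cong (a * a *_) (^-distribʳ-* b 3 3) ⟩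
  a * a * (3 ^ b * 3 ^ b)      ≡⟨ rearrange a (3 ^ b) ⟩
  (a * 3 ^ b) ^ 2              ∎
  where
  open ≤-Reasoning
  rearrange : ∀ a x → a * a * (x * x) ≡ a * x * (a * x * 1)
  rearrange = ℕ-Solver.solve-∀

decompose : ∀ r → 2 ≤ r → ∃[ a ] ∃[ b ] (a ≡ 2 ⊎ a ≡ 3 ⊎ a ≡ 4) × r ≡ a + 3 * b
decompose r 2≤r = 2 + (r ∸ 2) % 3 , (r ∸ 2) / 3 , residue ((r ∸ 2) % 3) (m%n<n (r ∸ 2) 3) , (begin
  r                                                ≡⟨ m+[n∸m]≡n 2≤r ⟨
  2 + (r ∸ 2)                                      ≡⟨ cong (λ z → 2 + z) (m≡m%n+[m/n]*n (r ∸ 2) 3) ⟩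
  2 + ((r ∸ 2) % 3 + (r ∸ 2) / 3 * 3)              ≡⟨ cong (λ z → 2 + ((r ∸ 2) % 3 + z)) (*-comm ((r ∸ 2) / 3) 3) ⟩
  2 + (r ∸ 2) % 3 + 3 * ((r ∸ 2) / 3)              ∎)
  where
  open ≡-Reasoning
  residue : ∀ i → i < 3 → 2 + i ≡ 2 ⊎ 2 + i ≡ 3 ⊎ 2 + i ≡ 4
  residue 0 _ = inj₁ refl
  residue 1 _ = inj₂ (inj₁ refl)
  residue 2 _ = inj₂ (inj₂ refl)
  residue (suc (suc (suc _))) (s≤s (s≤s (s≤s ())))

-- The 4 is a product of two squares: with `ν = 1` a colouring for `k - 1` satisfies
-- `R ^ (k - 1) ≤ M ^ 2`, and `2 ^ r ≤ R ^ 2`.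
inverse-bound : ∀ r a b y .{{_ : NonZero r}} → a ≡ 2 ⊎ a ≡ 3 ⊎ a ≡ 4 → r ≡ a + 3 * b → Fraction y (+ 4) (+ r) →
  ∃[ D ] (∀ N → 1 ≤ N → ∀ k → Is-f r N k → (fromℕ k ℚ.- D) ≤ y *log₂ N)
inverse-bound r a b y a∈ refl y≡4/r =
  let K , colourable = colouring-exists a b 1 (proj₁ (range a∈)) (proj₂ (range a∈))
  -- For `k` up to this constant the left-hand side is not positive; beyond it `k - 1` exceeds `K`
  -- and has a colouring.
  in fromℕ (2 + K) , λ N 1≤N k k-minimal →
    ≤*log₂-intro 1≤N (difference k (2 + K)) (difference≤ k (2 + K)) y≡4/r
      (small N 1≤N k K (proj₂ k-minimal) (colourable (k ∸ 1)))
  where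
  R : ℕ
  R = a * 3 ^ b
  difference : ∀ k δ → Fraction (fromℕ k ℚ.- fromℕ δ) (+ k ℤ.- + δ) (+ 1)
  difference k δ = subst₂ (Fraction (fromℕ k ℚ.- fromℕ δ)) (first (+ k) (+ δ)) refl
    (fraction-+ (fraction-/ (+ k) 1) (fraction-neg (fraction-/ (+ δ) 1)))
    where
    first : ∀ i j → i ℤ.* + 1 ℤ.+ (ℤ.- j) ℤ.* + 1 ≡ i ℤ.- j
    first = solve-∀
  difference≤ : ∀ k δ → + k ℤ.- + δ ℤ.≤ + (k ∸ δ)
  difference≤ k δ with ≤-total δ k
  ... | inj₁ δ≤k = ℤ.≤-reflexive (trans (ℤ.[+m]-[+n]≡m⊖n k δ) (ℤ.⊖-≥ δ≤k))
  ... | inj₂ k≤δ = ℤ.≤-trans (ℤ.≤-reflexive (ℤ.[+m]-[+n]≡m⊖n k δ))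
                     (ℤ.≤-trans (ℤ.≤-reflexive (ℤ.⊖-≤ k≤δ)) (ℤ.≤-trans ℤ.neg-≤-pos (ℤ.+≤+ z≤n)))
  small : ∀ N → 1 ≤ N → ∀ k K → (∀ κ → ∃[ c ] ¬ HasMonoAP {r} {N} κ c → k ≤ κ) →
          (K < k ∸ 1 → Colourable a b 1 (k ∸ 1)) → 2 ^ (r * (k ∸ (2 + K))) ≤ N ^ 4
  small N 1≤N k K k-least colourable with k ≤? 2 + K
  ... | yes k≤ = subst (λ z → 2 ^ (r * z) ≤ N ^ 4) (sym (m≤n⇒m∸n≡0 k≤))
                   (subst (λ z → 2 ^ z ≤ N ^ 4) (sym (*-zeroʳ r)) (m^n>0 N {{>-nonZero 1≤N}} 4))
  ... | no k≰ with k | ≰⇒> k≰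
  ...   | suc (suc κ) | s≤s (s≤s K≤κ) with colourable (s≤s (<⇒≤ K≤κ))
  ...     | M , f , f-free , R^≤M² = begin
      2 ^ (r * (κ ∸ K))                 ≤⟨ ^-monoʳ-≤ 2 (*-monoʳ-≤ r (≤-trans (m∸n≤m κ K) (n≤1+n κ))) ⟩
      2 ^ (r * suc κ)                   ≡⟨ ^-*-assoc 2 r (suc κ) ⟨
      (2 ^ r) ^ suc κ                   ≤⟨ ^-monoˡ-≤ (suc κ) (2^r≤R² a b a∈) ⟩
      (R ^ 2) ^ suc κ                   ≡⟨ ^-commute R 2 (suc κ) ⟩
      (R ^ suc κ) ^ 2                   ≡⟨ cong (λ z → (R ^ z) ^ 2) (*-identityˡ (suc κ)) ⟨
      (R ^ (1 * suc κ)) ^ 2             ≤⟨ ^-monoˡ-≤ 2 (≤-trans R^≤M² (^-monoˡ-≤ 2 (<⇒≤ M<N))) ⟩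
      (N ^ 2) ^ 2                       ≡⟨ ^-*-assoc N 2 2 ⟩
      N ^ 4                             ∎
      where
      open ≤-Reasoning
      -- By minimality of `k` no colouring of `[ N ]` avoids progressions of length `k - 1`, so the
      -- one of size `M` cannot cover it.
      M<N : M < N
      M<N = ≰⇒> λ N≤M → <-irrefl refl (k-least (suc κ) (restriction f f-free N≤M , no-mono-AP f f-free N≤M))

theorem1 : (∀ (r a b : ℕ) → 2 ≤ r → (a ≡ 2 ⊎ a ≡ 3 ⊎ a ≡ 4) → r ≡ a + 3 * b →
    ∀ (η : ℚ) → 0ℚ ℚ.< η →
    ∃[ K ] (∀ (k : ℕ) → K < k → ∀ (w : ℕ) → Is-w k r w →
    (a * 3 ^ b) ↑ ((1ℚ ℚ.- η) ℚ.* fromℕ k) < w))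
    ×
    (∃[ C ] (0ℚ ℚ.< C × (∀ (r : ℕ) .{{_ : NonZero r}} → 2 ≤ r →
    ∃[ D ] (∀ (N : ℕ) → 1 ≤ N → ∀ (k : ℕ) → Is-f r N k →
    (fromℕ k ℚ.- D) ≤ (C ℚ.* (+ 1 ℚ./ r)) *log₂ N))))
theorem1 =
  (λ { _ a b _ a∈ refl η 0<η → lower-bound a b (proj₁ (range a∈)) (proj₂ (range a∈)) η 0<η }) ,
  fromℕ 4 , from-yes (0ℚ ℚ.<? fromℕ 4) ,
  λ r 2≤r → let a , b , a∈ , r≡ = decompose r 2≤r 
    in inverse-bound r a b (fromℕ 4 ℚ.* (+ 1 ℚ./ r)) a∈ r≡
         (subst (Fraction _ (+ 4)) (ℤ.*-identityˡ (+ r)) (fraction-* (fraction-/ (+ 4) 1) (fraction-/ (+ 1) r)))
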